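{- The following theories are not quasi-VC-minimal: $\mathrm{Th}(\mathbb{Q}_p; +, \cdot, |)$ for any prime $p$, and $\mathrm{Th}(k((t)); +, \cdot, |)$ for any field $k$.
   Context: $\mathbb{Q}_p$ carries its $p$-adic valuation and $k((t))$ (formal Laurent series) its $t$-adic valuation $v$; $x\mid y$ is the binary relation meaning $v(x)\le v(y)$. Directedness: for a set $X$, a family $\mathcal{B}\subseteq\mathcal{P}(X)$ is directed if for all $A,B\in\mathcal{B}$ either $A\subseteq B$, or $B\subseteq A$, or $A\cap B=\emptyset$. For a theory $T$, a set of formulas $\Psi=\{\psi_i(x;\bar y_i) : i\in I\}$ ($x$ a single variable, the parameter variables $\bar y_i$ may vary with $i$) is directed if for all $\mathfrak{M}\models T$ the family $\{\psi_i(\mathfrak{M};\bar a) : i\in I, \bar a\in M^{|\bar y_i|}\}$ is directed, where $\psi_i(\mathfrak{M};\bar a)=\{b\in M : \mathfrak{M}\models\psi_i(b;\bar a)\}$. Quasi-VC-minimality: $T$ is quasi-VC-minimal if there is a directed $\Psi$ such that every formula $\varphi(x)$ in the single variable $x$, with parameters from a model of $T$, is $T$-equivalent to a boolean combination of instances $\psi(x;\bar a)$ of formulas $\psi\in\Psi$ and parameter-free formulas in $x$. -}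

module Defs where

open import Algebra.Bundles using (CommutativeRing)
open import Data.Empty.Polymorphic using (⊥)
open import Data.Fin.Base using (Fin; toℕ)
open import Data.Integer.Base using (ℤ; +_; -[1+_])
import Data.Integer.Base as ℤ
import Data.Integer.Properties as ℤ
open import Data.Integer.Divisibility.Signed using (divides; ∣m∣n⇒∣m+n; ∣m⇒∣-m; ∣n⇒∣m*n; ∣m⇒∣m*n; *-cancelˡ-∣)
import Data.Integer.Divisibility.Signed as ℤ
open import Data.Integer.Solver using (module +-*-Solver)
open import Data.Nat.Base as ℕ using (ℕ; zero; suc; _∸_)
open import Data.Nat.Primality using (Prime; prime⇒nonZero)
open import Data.Product.Base using (Σ; ∃; ∃₂; _×_; _,_)
open import Data.Sum.Base using (_⊎_; inj₁; inj₂)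
open import Data.Vec.Base using (Vec; []; _∷_; lookup)
open import Data.Vec.Relation.Binary.Pointwise.Inductive using (Pointwise; []; _∷_)
open import Level using (Level; Lift; _⊔_; 0ℓ) renaming (suc to lsuc)
open import Relation.Binary.Bundles using (Setoid)
open import Relation.Binary.Core using (Rel)
open import Relation.Binary.PropositionalEquality.Core as ≡ using (_≡_)
open import Relation.Nullary.Construct.Add.Supremum using (_⁺; [_]; ⊤⁺)
open import Relation.Binary.Construct.Add.Supremum.NonStrict ℤ._≤_ using (_≤⁺_)
open import Relation.Nullary.Negation.Core using (¬_)
open import Relation.Unary using (Pred; _⊆_; _≐_; ∁; _∩_; _∪_) renaming (_⊥_ to Disjoint)
import Algebra.Construct.Pointwise as Pw
import Algebra.Definitions.RawMagma
import Algebra.Properties.CommutativeMonoid.Sum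
import Algebra.Properties.Semiring.Exp
import Algebra.Properties.Semiring.Sum
import Algebra.Solver.Ring.NaturalCoefficients.Default
import Relation.Binary.Reasoning.Setoid

record Language : Set₁ where
  field
    Function : ℕ → Set
    Relation : ℕ → Set

module _ (L : Language) where
  open Language L

  data Term (n : ℕ) : Set where
    var : Fin n → Term n
    app : ∀ {k} → Function k → Vec (Term n) k → Term n

  -- De Bruijn: in `Formula n` the free variables are `Fin n`, and ∀′ binds
  -- variable zero.  The logic is classical, so ⊥′, ⇒′, ∀′ suffice as a basis
  -- (¬ φ is φ ⇒′ ⊥′, ∃ is ¬ ∀ ¬, and so on).
  infix  6 _≈′_
  infixr 5 _⇒′_

  data Formula : ℕ → Set where
    ⊥′   : ∀ {n} → Formula n
    _≈′_ : ∀ {n} → Term n → Term n → Formula n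
    rel  : ∀ {n k} → Relation k → Vec (Term n) k → Formula n
    _⇒′_ : ∀ {n} → Formula n → Formula n → Formula n
    ∀′   : ∀ {n} → Formula (suc n) → Formula n

  Sentence : Set
  Sentence = Formula 0

  Theory : (t : Level) → Set (lsuc t)
  Theory t = Pred Sentence t

  -- The domain is a setoid whose equality interprets the equality symbol;
  -- this plays the role of a quotient set.
  record Structure (c ℓ : Level) : Set (lsuc (c ⊔ ℓ)) where
    field
      domain   : Setoid c ℓ
    open Setoid domain public
    field
      fun      : ∀ {k} → Function k → Vec Carrier k → Carrier
      fun-cong : ∀ {k} (f : Function k) {as bs : Vec Carrier k} →
                 Pointwise _≈_ as bs → fun f as ≈ fun f bs
      holds      : ∀ {k} → Relation k → Vec Carrier k → Set (c ⊔ ℓ)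
      holds-resp : ∀ {k} (R : Relation k) {as bs : Vec Carrier k} →
                   Pointwise _≈_ as bs → holds R as → holds R bs

module _ {L : Language} {c ℓ : Level} (M : Structure L c ℓ) where
  open Structure M

  mutual
    evalTerm : ∀ {n} → Vec Carrier n → Term L n → Carrier
    evalTerm ρ (var i)    = lookup ρ i
    evalTerm ρ (app f ts) = fun f (evalTerms ρ ts)

    evalTerms : ∀ {n k} → Vec Carrier n → Vec (Term L n) k → Vec Carrier k
    evalTerms ρ []       = []
    evalTerms ρ (t ∷ ts) = evalTerm ρ t ∷ evalTerms ρ ts

  Satisfies : ∀ {n} → Formula L n → Vec Carrier n → Set (c ⊔ ℓ)
  Satisfies ⊥′         ρ = ⊥
  Satisfies (s ≈′ t)   ρ = Lift c (evalTerm ρ s ≈ evalTerm ρ t)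
  Satisfies (rel R ts) ρ = holds R (evalTerms ρ ts)
  Satisfies (φ ⇒′ ψ)   ρ = Satisfies φ ρ → Satisfies ψ ρ
  Satisfies (∀′ φ)     ρ = ∀ a → Satisfies φ (a ∷ ρ)

  -- φ(M; ā): variable zero is x, the remaining variables are the parameters.
  definedSet : ∀ {n} → Formula L (suc n) → Vec Carrier n → Pred Carrier (c ⊔ ℓ)
  definedSet φ as b = Satisfies φ (b ∷ as)

  Th : Theory L (c ⊔ ℓ)
  Th σ = Satisfies σ []

  infix 4 _⊨ᵀ_
  _⊨ᵀ_ : ∀ {t} → Theory L t → Set (c ⊔ ℓ ⊔ t)
  _⊨ᵀ_ T = ∀ {σ} → T σ → Satisfies σ []

Directed : ∀ {i a ℓ} {I : Set i} {X : Set a} → (I → Pred X ℓ) → Set (i ⊔ a ⊔ ℓ)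
Directed B = ∀ i j → B i ⊆ B j ⊎ B j ⊆ B i ⊎ Disjoint (B i) (B j)

infixr 7 _∧_
infixr 6 _∨_

data BooleanCombination {g} (G : Set g) : Set g where
  gen     : G → BooleanCombination G
  ¬′_     : BooleanCombination G → BooleanCombination G
  _∧_ _∨_ : BooleanCombination G → BooleanCombination G → BooleanCombination G

evalBool : ∀ {g a ℓ} {G : Set g} {X : Set a} →
           (G → Pred X ℓ) → BooleanCombination G → Pred X ℓ
evalBool S (gen x) = S x
evalBool S (¬′ β)  = ∁ (evalBool S β)
evalBool S (β ∧ γ) = evalBool S β ∩ evalBool S γ
evalBool S (β ∨ γ) = evalBool S β ∪ evalBool S γ

record FormulaFamily (L : Language) : Set₁ where
  field
    Index : Set
    arity : Index → ℕ
    ψ     : (i : Index) → Formula L (suc (arity i))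

module _ {L : Language} (Ψ : FormulaFamily L) where
  open FormulaFamily Ψ

  Instance : ∀ {c ℓ} → Structure L c ℓ → Set c
  Instance M = Σ Index (λ i → Vec (Structure.Carrier M) (arity i))

  instanceSet : ∀ {c ℓ} (M : Structure L c ℓ) →
                Instance M → Pred (Structure.Carrier M) (c ⊔ ℓ)
  instanceSet M (i , as) = definedSet M (ψ i) as

  -- Generators of the boolean combinations: instances of members of Ψ, and
  -- parameter-free formulas in x.
  Generator : ∀ {c ℓ} → Structure L c ℓ → Set c
  Generator M = Instance M ⊎ Formula L 1

  generatorSet : ∀ {c ℓ} (M : Structure L c ℓ) →
                 Generator M → Pred (Structure.Carrier M) (c ⊔ ℓ)
  generatorSet M (inj₁ inst) = instanceSet M inst
  generatorSet M (inj₂ χ)    = definedSet M χ []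

-- The models range over the structures in the universes c, ℓ.
module _ {L : Language} {t : Level} (c ℓ : Level) (T : Theory L t) where

  DirectedFormulas : FormulaFamily L → Set (t ⊔ lsuc (c ⊔ ℓ))
  DirectedFormulas Ψ =
    (M : Structure L c ℓ) → M ⊨ᵀ T → Directed (instanceSet Ψ M)

  -- For formulas with parameters in M, T-equivalence means equivalence modulo
  -- T together with the elementary diagram of M, that is, defining the same
  -- subset of M.
  QuasiVCMinimal : Set (t ⊔ lsuc (c ⊔ ℓ))
  QuasiVCMinimal =
    ∃ λ (Ψ : FormulaFamily L) → DirectedFormulas Ψ ×
      ((M : Structure L c ℓ) → M ⊨ᵀ T →
       ∀ {n} (φ : Formula L (suc n)) (as : Vec (Structure.Carrier M) n) →
       ∃ λ (β : BooleanCombination (Generator Ψ M)) →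
         definedSet M φ as ≐ evalBool (generatorSet Ψ M) β)

data DivFunction : ℕ → Set where
  plus times : DivFunction 2

data DivRelation : ℕ → Set where
  div : DivRelation 2

Lᵈⁱᵛ : Language
Lᵈⁱᵛ = record { Function = DivFunction ; Relation = DivRelation }

Cancellable : ∀ {c ℓ} (R : CommutativeRing c ℓ) → CommutativeRing.Carrier R → Set (c ⊔ ℓ)
Cancellable R π = ∀ x y → π * x ≈ π * y → x ≈ y
  where open CommutativeRing R

-- The localisation R[1/π] with its π-adic valuation.  It is applied to
-- discrete valuation rings R with uniformiser π, where R[1/π] is the
-- fraction field.
module Localisation {c ℓ : Level} (R : CommutativeRing c ℓ)
  (π : CommutativeRing.Carrier R) (π-cancel : Cancellable R π) where

  open CommutativeRing R
  open Algebra.Properties.Semiring.Exp semiring using (_^_; ^-homo-*)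
  open Algebra.Definitions.RawMagma *-rawMagma using (_∤_)
  open Algebra.Solver.Ring.NaturalCoefficients.Default commutativeSemiring
    using (solve; _:=_; _:+_; _:*_)

  -- a /π^ k represents a / πᵏ
  infix 5 _/π^_
  record Fraction : Set c where
    constructor _/π^_
    field
      numerator : Carrier
      exponent  : ℕ

  infix 4 _≋_
  _≋_ : Rel Fraction ℓ
  (a /π^ k) ≋ (b /π^ l) = π ^ l * a ≈ π ^ k * b

  infixl 6 _⊕_
  infixl 7 _⊗_

  _⊕_ _⊗_ : Fraction → Fraction → Fraction
  (a /π^ k) ⊕ (b /π^ l) = (π ^ l * a + π ^ k * b) /π^ (k ℕ.+ l)
  (a /π^ k) ⊗ (b /π^ l) = (a * b) /π^ (k ℕ.+ l)

  fromRing : Carrier → Fraction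
  fromRing a = a /π^ 0

  π^^_ : ℤ → Fraction
  π^^ (+ n)    = fromRing (π ^ n)
  π^^ -[1+ n ] = 1# /π^ suc n

  -- The graph of the valuation into ℤ ∪ {∞}: v(πᵞ u) = γ for u ∈ R with
  -- π ∤ u, and v(0) = ∞.
  data Valuation (x : Fraction) : ℤ ⁺ → Set (c ⊔ ℓ) where
    finite   : ∀ {γ} u → π ∤ u → x ≋ π^^ γ ⊗ fromRing u → Valuation x [ γ ]
    infinite : x ≋ fromRing 0# → Valuation x ⊤⁺

  infix 4 _∣ᵛ_
  _∣ᵛ_ : Rel Fraction (c ⊔ ℓ)
  x ∣ᵛ y = ∃₂ λ γ δ → Valuation x γ × Valuation y δ × γ ≤⁺ δ

  π^-cancel : ∀ n {x y} → π ^ n * x ≈ π ^ n * y → x ≈ y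
  π^-cancel zero    p = trans (sym (*-identityˡ _)) (trans p (*-identityˡ _))
  π^-cancel (suc n) p = π^-cancel n
    (π-cancel _ _ (trans (sym (*-assoc _ _ _)) (trans p (*-assoc _ _ _))))

  open Relation.Binary.Reasoning.Setoid setoid

  ≋-trans : ∀ {x y z} → x ≋ y → y ≋ z → x ≋ z
  ≋-trans {a /π^ k} {b /π^ l} {d /π^ m} p q = π^-cancel l (begin
    π ^ l * (π ^ m * a)  ≈⟨ swap (π ^ l) (π ^ m) a ⟩
    π ^ m * (π ^ l * a)  ≈⟨ *-congˡ p ⟩
    π ^ m * (π ^ k * b)  ≈⟨ swap (π ^ m) (π ^ k) b ⟩
    π ^ k * (π ^ m * b)  ≈⟨ *-congˡ q ⟩
    π ^ k * (π ^ l * d)  ≈⟨ swap (π ^ k) (π ^ l) d ⟩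
    π ^ l * (π ^ k * d)  ∎)
    where
    swap : ∀ u v w → u * (v * w) ≈ v * (u * w)
    swap = solve 3 (λ u v w → u :* (v :* w) := v :* (u :* w)) refl

  setoidᶠ : Setoid c ℓ
  setoidᶠ = record
    { Carrier       = Fraction
    ; _≈_           = _≋_
    ; isEquivalence = record
      { refl  = refl
      ; sym   = sym
      ; trans = λ {x} {y} {z} → ≋-trans {x} {y} {z}
      }
    }

  ⊕-cong : ∀ {x x′ y y′} → x ≋ x′ → y ≋ y′ → (x ⊕ y) ≋ (x′ ⊕ y′)
  ⊕-cong {a /π^ k} {a′ /π^ k′} {b /π^ l} {b′ /π^ l′} p q = begin
    π ^ (k′ ℕ.+ l′) * (π ^ l * a + π ^ k * b)
      ≈⟨ *-congʳ (^-homo-* π k′ l′) ⟩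
    (π ^ k′ * π ^ l′) * (π ^ l * a + π ^ k * b)
      ≈⟨ regroup (π ^ k′) (π ^ l′) (π ^ k) (π ^ l) a b ⟩
    (π ^ l′ * π ^ l) * (π ^ k′ * a) + (π ^ k′ * π ^ k) * (π ^ l′ * b)
      ≈⟨ +-cong (*-congˡ p) (*-congˡ q) ⟩
    (π ^ l′ * π ^ l) * (π ^ k * a′) + (π ^ k′ * π ^ k) * (π ^ l * b′)
      ≈⟨ regroup′ (π ^ k′) (π ^ l′) (π ^ k) (π ^ l) a′ b′ ⟩
    (π ^ k * π ^ l) * (π ^ l′ * a′ + π ^ k′ * b′)
      ≈⟨ *-congʳ (^-homo-* π k l) ⟨
    π ^ (k ℕ.+ l) * (π ^ l′ * a′ + π ^ k′ * b′)
      ∎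
    where
    regroup : ∀ k′ l′ k l a b → (k′ * l′) * (l * a + k * b) ≈
              (l′ * l) * (k′ * a) + (k′ * k) * (l′ * b)
    regroup = solve 6 (λ k′ l′ k l a b → (k′ :* l′) :* (l :* a :+ k :* b) :=
              (l′ :* l) :* (k′ :* a) :+ (k′ :* k) :* (l′ :* b)) refl
    regroup′ : ∀ k′ l′ k l a b →
               (l′ * l) * (k * a) + (k′ * k) * (l * b) ≈
               (k * l) * (l′ * a + k′ * b)
    regroup′ = solve 6 (λ k′ l′ k l a b →
               (l′ :* l) :* (k :* a) :+ (k′ :* k) :* (l :* b) :=
               (k :* l) :* (l′ :* a :+ k′ :* b)) refl

  ⊗-cong : ∀ {x x′ y y′} → x ≋ x′ → y ≋ y′ → (x ⊗ y) ≋ (x′ ⊗ y′)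
  ⊗-cong {a /π^ k} {a′ /π^ k′} {b /π^ l} {b′ /π^ l′} p q = begin
    π ^ (k′ ℕ.+ l′) * (a * b)      ≈⟨ *-congʳ (^-homo-* π k′ l′) ⟩
    (π ^ k′ * π ^ l′) * (a * b)    ≈⟨ interchange (π ^ k′) (π ^ l′) a b ⟩
    (π ^ k′ * a) * (π ^ l′ * b)    ≈⟨ *-cong p q ⟩
    (π ^ k * a′) * (π ^ l * b′)    ≈⟨ interchange (π ^ k) (π ^ l) a′ b′ ⟨
    (π ^ k * π ^ l) * (a′ * b′)    ≈⟨ *-congʳ (^-homo-* π k l) ⟨
    π ^ (k ℕ.+ l) * (a′ * b′)      ∎
    where
    interchange : ∀ u v a b → (u * v) * (a * b) ≈ (u * a) * (v * b)
    interchange = solve 4 (λ u v a b →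
      (u :* v) :* (a :* b) := (u :* a) :* (v :* b)) refl

  Valuation-resp : ∀ {x y γ} → x ≋ y → Valuation x γ → Valuation y γ
  Valuation-resp {x} {y} p (finite {γ} u π∤u q) =
    finite u π∤u (≋-trans {y} {x} {π^^ γ ⊗ fromRing u} (sym p) q)
  Valuation-resp {x} {y} p (infinite q) =
    infinite (≋-trans {y} {x} {fromRing 0#} (sym p) q)

  structure : Structure Lᵈⁱᵛ c ℓ
  structure = record
    { domain     = setoidᶠ
    ; fun        = λ where
        plus  (x ∷ y ∷ []) → x ⊕ y
        times (x ∷ y ∷ []) → x ⊗ y
    ; fun-cong   = λ where
        plus  {x ∷ y ∷ []} {x′ ∷ y′ ∷ []} (p ∷ q ∷ []) → ⊕-cong {x} {x′} {y} {y′} p q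
        times {x ∷ y ∷ []} {x′ ∷ y′ ∷ []} (p ∷ q ∷ []) → ⊗-cong {x} {x′} {y} {y′} p q
    ; holds      = λ where
        div (x ∷ y ∷ []) → x ∣ᵛ y
    ; holds-resp = λ where
        div {x ∷ y ∷ []} {x′ ∷ y′ ∷ []} (p ∷ q ∷ []) (γ , δ , vx , vy , γ≤δ) →
          γ , δ , Valuation-resp {x} {x′} p vx , Valuation-resp {y} {y′} q vy , γ≤δ
    }

-- The p-adic numbers: ℤₚ is the inverse limit of the rings ℤ/pⁿ, and
-- ℚₚ = ℤₚ[1/p].

module PAdic (p : ℕ) .{{_ : ℕ.NonZero p}} where

  pⁿ : ℕ → ℤ
  pⁿ n = (+ p) ℤ.^ n

  infix 4 _≡_[mod_]
  _≡_[mod_] : ℤ → ℤ → ℤ → Set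
  a ≡ b [mod m ] = m ℤ.∣ a ℤ.- b

  refl-mod : ∀ {m} a → a ≡ a [mod m ]
  refl-mod a = divides (+ 0) (ℤ.+-inverseʳ a)

  ≡⇒≡mod : ∀ {m a b} → a ≡ b → a ≡ b [mod m ]
  ≡⇒≡mod {a = a} ≡.refl = refl-mod a

  via : ∀ {m a b} → m ℤ.∣ a → a ≡ b → m ℤ.∣ b
  via d ≡.refl = d

  open +-*-Solver using (solve; _:=_; _:+_; _:*_; _:-_; :-_)

  sym-mod : ∀ {m} a b → a ≡ b [mod m ] → b ≡ a [mod m ]
  sym-mod a b d = via (∣m⇒∣-m d) (solve 2 (λ a b → :- (a :- b) := b :- a) ≡.refl a b)

  trans-mod : ∀ {m} a b c → a ≡ b [mod m ] → b ≡ c [mod m ] → a ≡ c [mod m ]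
  trans-mod a b c d e = via (∣m∣n⇒∣m+n d e)
    (solve 3 (λ a b c → (a :- b) :+ (b :- c) := a :- c) ≡.refl a b c)

  +-mod : ∀ {m} a b c d → a ≡ b [mod m ] → c ≡ d [mod m ] →
          a ℤ.+ c ≡ b ℤ.+ d [mod m ]
  +-mod a b c d p q = via (∣m∣n⇒∣m+n p q)
    (solve 4 (λ a b c d → (a :- b) :+ (c :- d) := (a :+ c) :- (b :+ d)) ≡.refl a b c d)

  *-mod : ∀ {m} a b c d → a ≡ b [mod m ] → c ≡ d [mod m ] →
          a ℤ.* c ≡ b ℤ.* d [mod m ]
  *-mod a b c d p q = via (∣m∣n⇒∣m+n (∣m⇒∣m*n c p) (∣n⇒∣m*n b q))
    (solve 4 (λ a b c d → (a :- b) :* c :+ b :* (c :- d) := a :* c :- b :* d) ≡.refl a b c d)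

  neg-mod : ∀ {m} a b → a ≡ b [mod m ] → ℤ.- a ≡ ℤ.- b [mod m ]
  neg-mod a b d = via (∣m⇒∣-m d)
    (solve 2 (λ a b → :- (a :- b) := :- a :- :- b) ≡.refl a b)

  -- The n-th entry represents a residue class modulo pⁿ.
  record ℤₚ : Set where
    field
      residue  : ℕ → ℤ
      coherent : ∀ n → residue (suc n) ≡ residue n [mod pⁿ n ]
  open ℤₚ

  const : ℤ → ℤₚ
  const a = record { residue = λ _ → a ; coherent = λ _ → refl-mod a }

  _+ₚ_ _*ₚ_ : ℤₚ → ℤₚ → ℤₚ
  x +ₚ y = record
    { residue  = λ n → residue x n ℤ.+ residue y n
    ; coherent = λ n → +-mod (residue x (suc n)) _ _ _ (coherent x n) (coherent y n)
    }
  x *ₚ y = record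
    { residue  = λ n → residue x n ℤ.* residue y n
    ; coherent = λ n → *-mod (residue x (suc n)) _ _ _ (coherent x n) (coherent y n)
    }

  -ₚ_ : ℤₚ → ℤₚ
  -ₚ x = record
    { residue  = λ n → ℤ.- residue x n
    ; coherent = λ n → neg-mod (residue x (suc n)) _ (coherent x n)
    }

  _≈ₚ_ : Rel ℤₚ 0ℓ
  x ≈ₚ y = ∀ n → residue x n ≡ residue y n [mod pⁿ n ]

  ℤₚ-commutativeRing : CommutativeRing 0ℓ 0ℓ
  ℤₚ-commutativeRing = record
    { Carrier = ℤₚ
    ; _≈_ = _≈ₚ_
    ; _+_ = _+ₚ_
    ; _*_ = _*ₚ_
    ; -_  = -ₚ_
    ; 0#  = const (+ 0)
    ; 1#  = const (+ 1)
    ; isCommutativeRing = record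
      { isRing = record
        { +-isAbelianGroup = record
          { isGroup = record
            { isMonoid = record
              { isSemigroup = record
                { isMagma = record
                  { isEquivalence = record
                    { refl  = λ {x} n → refl-mod (residue x n)
                    ; sym   = λ {x} {y} d n → sym-mod (residue x n) (residue y n) (d n)
                    ; trans = λ {x} {y} d e n → trans-mod (residue x n) (residue y n) _ (d n) (e n)
                    }
                  ; ∙-cong = λ {x} {y} {u} {v} d e n →
                      +-mod (residue x n) (residue y n) (residue u n) (residue v n) (d n) (e n)
                  }
                ; assoc = λ x y z n → ≡⇒≡mod (ℤ.+-assoc (residue x n) (residue y n) (residue z n))
                }
              ; identity = (λ x n → ≡⇒≡mod (ℤ.+-identityˡ (residue x n)))
                         , (λ x n → ≡⇒≡mod (ℤ.+-identityʳ (residue x n)))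
              }
            ; inverse = (λ x n → ≡⇒≡mod (ℤ.+-inverseˡ (residue x n)))
                      , (λ x n → ≡⇒≡mod (ℤ.+-inverseʳ (residue x n)))
            ; ⁻¹-cong = λ {x} {y} d n → neg-mod (residue x n) (residue y n) (d n)
            }
          ; comm = λ x y n → ≡⇒≡mod (ℤ.+-comm (residue x n) (residue y n))
          }
        ; *-cong = λ {x} {y} {u} {v} d e n →
            *-mod (residue x n) (residue y n) (residue u n) (residue v n) (d n) (e n)
        ; *-assoc = λ x y z n → ≡⇒≡mod (ℤ.*-assoc (residue x n) (residue y n) (residue z n))
        ; *-identity = (λ x n → ≡⇒≡mod (ℤ.*-identityˡ (residue x n)))
                     , (λ x n → ≡⇒≡mod (ℤ.*-identityʳ (residue x n)))
        ; distrib = (λ x y z n → ≡⇒≡mod (ℤ.*-distribˡ-+ (residue x n) (residue y n) (residue z n)))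
                  , (λ x y z n → ≡⇒≡mod (ℤ.*-distribʳ-+ (residue x n) (residue y n) (residue z n)))
        }
      ; *-comm = λ x y n → ≡⇒≡mod (ℤ.*-comm (residue x n) (residue y n))
      }
    }

  p-cancel : ∀ x y → (const (+ p) *ₚ x) ≈ₚ (const (+ p) *ₚ y) → x ≈ₚ y
  p-cancel x y d n =
    trans-mod x₀ x₁ y₀ (sym-mod x₁ x₀ (coherent x n))
      (trans-mod x₁ y₁ y₀ x₁≡y₁ (coherent y n))
    where
    x₀ = residue x n
    x₁ = residue x (suc n)
    y₀ = residue y n
    y₁ = residue y (suc n)
    x₁≡y₁ : x₁ ≡ y₁ [mod pⁿ n ]
    x₁≡y₁ = *-cancelˡ-∣ (+ p) (via (d (suc n))
      (solve 3 (λ p a b → p :* a :- p :* b := p :* (a :- b)) ≡.refl (+ p) x₁ y₁))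

  open Localisation ℤₚ-commutativeRing (const (+ p)) p-cancel public

ℚₚ : (p : ℕ) → Prime p → Structure Lᵈⁱᵛ 0ℓ 0ℓ
ℚₚ p isPrime = PAdic.structure p
  where instance _ = prime⇒nonZero isPrime

record IsField {c ℓ} (k : CommutativeRing c ℓ) : Set (c ⊔ ℓ) where
  open CommutativeRing k
  field
    0≉1     : ¬ 0# ≈ 1#
    inverse : ∀ x → ¬ x ≈ 0# → ∃ λ y → x * y ≈ 1#

module PowerSeries {c ℓ} (k : CommutativeRing c ℓ) where
  open CommutativeRing k
  open Algebra.Properties.CommutativeMonoid.Sum +-commutativeMonoid
    using (sum; sum⁺-syntax; sum-cong-≋; sum-replicate-zero; ∑-distrib-+)
  open Algebra.Properties.Semiring.Sum semiring using (*-distribˡ-sum)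
  open Algebra.Solver.Ring.NaturalCoefficients.Default commutativeSemiring
    using (solve; _:=_; _:+_; _:*_)
  open Relation.Binary.Reasoning.Setoid setoid

  -- f n is the coefficient of tⁿ
  Series : Set c
  Series = ℕ → Carrier

  infixl 7 _⋆_
  _⋆_ : Series → Series → Series
  (f ⋆ g) n = ∑[ i ≤ n ] (f (toℕ i) * g (n ∸ toℕ i))

  one : Series
  one zero    = 1#
  one (suc _) = 0#

  t : Series
  t 1 = 1#
  t _ = 0#

  infix 4 _≈ˢ_
  _≈ˢ_ : Rel Series ℓ
  f ≈ˢ g = ∀ n → f n ≈ g n

  infixl 6 _+ˢ_
  _+ˢ_ : Series → Series → Series
  (f +ˢ g) n = f n + g n

  tail : Series → Series
  tail f n = f (suc n)

  infixr 8 _·_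
  _·_ : Carrier → Series → Series
  (a · f) n = a * f n

  ⋆-cong : ∀ {f f′ g g′} → f ≈ˢ f′ → g ≈ˢ g′ → f ⋆ g ≈ˢ f′ ⋆ g′
  ⋆-cong p q n = sum-cong-≋ {suc n} (λ i → *-cong (p (toℕ i)) (q (n ∸ toℕ i)))

  ⋆-distribʳ : ∀ h f g → (f +ˢ g) ⋆ h ≈ˢ f ⋆ h +ˢ g ⋆ h
  ⋆-distribʳ h f g n = trans
    (sum-cong-≋ {suc n} (λ i → distribʳ (h (n ∸ toℕ i)) (f (toℕ i)) (g (toℕ i))))
    (∑-distrib-+ {suc n} (λ i → f (toℕ i) * h (n ∸ toℕ i)) (λ i → g (toℕ i) * h (n ∸ toℕ i)))

  ·-⋆ : ∀ a f g → (a · f) ⋆ g ≈ˢ a · (f ⋆ g)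
  ·-⋆ a f g n = trans
    (sum-cong-≋ {suc n} (λ i → *-assoc a (f (toℕ i)) (g (n ∸ toℕ i))))
    (sym (*-distribˡ-sum {suc n} a (λ i → f (toℕ i) * g (n ∸ toℕ i))))

  ⋆-zeroˡ : ∀ f → (λ _ → 0#) ⋆ f ≈ˢ (λ _ → 0#)
  ⋆-zeroˡ f n = trans
    (sum-cong-≋ {suc n} (λ i → zeroˡ (f (n ∸ toℕ i))))
    (sum-replicate-zero (suc n))

  ⋆-identityˡ : ∀ f → one ⋆ f ≈ˢ f
  ⋆-identityˡ f zero    = trans (+-identityʳ _) (*-identityˡ _)
  ⋆-identityˡ f (suc n) =
    trans (+-cong (*-identityˡ _) (⋆-zeroˡ f n)) (+-identityʳ _)

  ⋆-sucʳ : ∀ f g n → (f ⋆ g) (suc n) ≈ (f ⋆ tail g) n + f (suc n) * g 0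
  ⋆-sucʳ f g zero    =
    solve 3 (λ a b z → a :+ (b :+ z) := (a :+ z) :+ b) refl (f 0 * g 1) (f 1 * g 0) 0#
  ⋆-sucʳ f g (suc n) =
    trans (+-congˡ (⋆-sucʳ (tail f) g n)) (sym (+-assoc _ _ _))

  ⋆-comm : ∀ f g → f ⋆ g ≈ˢ g ⋆ f
  ⋆-comm f g zero    = +-congʳ (*-comm _ _)
  ⋆-comm f g (suc n) = begin
    f 0 * g (suc n) + (tail f ⋆ g) n  ≈⟨ +-cong (*-comm _ _) (⋆-comm (tail f) g n) ⟩
    g (suc n) * f 0 + (g ⋆ tail f) n  ≈⟨ +-comm _ _ ⟩
    (g ⋆ tail f) n + g (suc n) * f 0  ≈⟨ ⋆-sucʳ g f n ⟨
    (g ⋆ f) (suc n)                   ∎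

  ⋆-assoc : ∀ f g h → (f ⋆ g) ⋆ h ≈ˢ f ⋆ (g ⋆ h)
  ⋆-assoc f g h zero    = begin
    (f 0 * g 0 + 0#) * h 0 + 0#  ≈⟨ +-congʳ (*-congʳ (+-identityʳ _)) ⟩
    (f 0 * g 0) * h 0 + 0#       ≈⟨ +-congʳ (*-assoc _ _ _) ⟩
    f 0 * (g 0 * h 0) + 0#       ≈⟨ +-congʳ (*-congˡ (+-identityʳ _)) ⟨
    f 0 * (g 0 * h 0 + 0#) + 0#  ∎
  ⋆-assoc f g h (suc n) = begin
    (f 0 * g 0 + 0#) * h (suc n) + ((f 0 · tail g +ˢ tail f ⋆ g) ⋆ h) n
      ≈⟨ +-cong (*-congʳ (+-identityʳ _)) (⋆-distribʳ h (f 0 · tail g) (tail f ⋆ g) n) ⟩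
    (f 0 * g 0) * h (suc n) + (((f 0 · tail g) ⋆ h) n + ((tail f ⋆ g) ⋆ h) n)
      ≈⟨ +-congˡ (+-cong (·-⋆ (f 0) (tail g) h n) (⋆-assoc (tail f) g h n)) ⟩
    (f 0 * g 0) * h (suc n) + (f 0 * (tail g ⋆ h) n + (tail f ⋆ (g ⋆ h)) n)
      ≈⟨ solve 5 (λ a b c d e → (a :* b) :* c :+ (a :* d :+ e) := a :* (b :* c :+ d) :+ e) refl
           (f 0) (g 0) (h (suc n)) ((tail g ⋆ h) n) ((tail f ⋆ (g ⋆ h)) n) ⟩
    f 0 * (g 0 * h (suc n) + (tail g ⋆ h) n) + (tail f ⋆ (g ⋆ h)) n
      ∎

  t⋆-suc : ∀ f n → (t ⋆ f) (suc n) ≈ f n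
  t⋆-suc f n = begin
    0# * f (suc n) + (tail t ⋆ f) n  ≈⟨ +-cong (zeroˡ _) (⋆-cong {g = f} tail-t (λ _ → refl) n) ⟩
    0# + (one ⋆ f) n                 ≈⟨ +-identityˡ _ ⟩
    (one ⋆ f) n                      ≈⟨ ⋆-identityˡ f n ⟩
    f n                              ∎
    where
    tail-t : tail t ≈ˢ one
    tail-t zero    = refl
    tail-t (suc _) = refl

  t-cancel : ∀ f g → t ⋆ f ≈ˢ t ⋆ g → f ≈ˢ g
  t-cancel f g p n = trans (sym (t⋆-suc f n)) (trans (p (suc n)) (t⋆-suc g n))

  commutativeRing : CommutativeRing c ℓ
  commutativeRing = record
    { Carrier = Series
    ; _≈_ = _≈ˢ_
    ; _+_ = _+ˢ_
    ; _*_ = _⋆_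
    ; -_  = λ f n → - f n
    ; 0#  = λ _ → 0#
    ; 1#  = one
    ; isCommutativeRing = record
      { isRing = record
        { +-isAbelianGroup = Pw.isAbelianGroup ℕ +-isAbelianGroup
        ; *-cong     = ⋆-cong
        ; *-assoc    = ⋆-assoc
        ; *-identity = ⋆-identityˡ , λ f n → trans (⋆-comm f one n) (⋆-identityˡ f n)
        ; distrib    =
            (λ h f g n → trans (⋆-comm h (f +ˢ g) n) (trans (⋆-distribʳ h f g n)
                           (+-cong (⋆-comm f h n) (⋆-comm g h n))))
          , ⋆-distribʳ
        }
      ; *-comm = ⋆-comm
      }
    }

  open Localisation commutativeRing t t-cancel public using (structure)

-- Formal Laurent series as k((t)) = k[[t]][1/t].
_⟨⟨t⟩⟩ : ∀ {c ℓ} → CommutativeRing c ℓ → Structure Lᵈⁱᵛ c ℓ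
k ⟨⟨t⟩⟩ = PowerSeries.structure k

{-# OPTIONS --safe #-}

-- Let S a = {x : v(x − a) is even}.  There are only countably many
-- parameter-free formulas, so if every S a were a boolean combination as in
-- the definition of quasi-VC-minimality, the Baire category theorem would give
-- a ball B, a set C dense in B on which finitely many parameter-free formulas
-- are constant, and an N such that for densely many a ∈ B the set S a ∩ C is a
-- boolean combination of at most N members "of a" of the directed family.
--
-- Take N minimal.  Then inside every ball each D in the family is constant on
-- C ∩ V for some ball V: otherwise D and its complement are both dense in C,
-- and on one of them a member of a is redundant for densely many a.  Likewise
-- every ball U contains a b no member of which is constant on C ∩ U.
--
-- Fix such an a.  By pigeonhole there are y, y′ ∈ C which the members of a do
-- not separate, with v(y − a) = n and v(y′ − a) > n + 1.  Choose a ball U, of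
-- points u with v(u − a) = n + 1, on which the members of a are constant, and
-- b ∈ U no member of which is constant on C ∩ U.  As S a separates U from y,
-- so does some member E of a; by directedness no member of b, splitting C ∩ U,
-- separates y from y′, which both lie on the other side of E.  But S b does,
-- since v(y − b) = n and v(y′ − b) = n + 1.
module Submission where

open import Defs
open import Algebra.Bundles using (CommutativeRing)
import Algebra.Definitions.RawMagma
import Algebra.Properties.CommutativeSemigroup
import Algebra.Properties.Ring
import Algebra.Properties.Semiring.Exp
import Algebra.Solver.Ring.NaturalCoefficients.Default
open import Axiom.ExcludedMiddle using (ExcludedMiddle)
open import Data.Empty using (⊥; ⊥-elim)
import Data.Empty.Polymorphic as Polymorphic
open import Data.Fin.Base as Fin using (Fin; zero; suc; toℕ; punchIn; punchOut; funToFin; finToFun)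
import Data.Fin.Properties as Fin
open import Data.Integer.Base as ℤ using (ℤ; +_; -[1+_])
open import Data.Integer.Divisibility.Signed as ℤ using (divides)
import Data.Integer.Properties as ℤ
import Data.Integer.Solver
open import Data.List.Base as List using (List; []; _∷_; _++_; map; allFin; cartesianProductWith; length)
open import Data.List.Membership.Propositional using (_∈_)
open import Data.List.Membership.Propositional.Properties
  using (∈-map⁺; ∈-++⁺ˡ; ∈-++⁺ʳ; ∈-allFin; ∈-cartesianProductWith⁺)
import Data.List.Properties as List
open import Data.List.Relation.Unary.All as All using (All; []; _∷_)
import Data.List.Relation.Unary.All.Properties as All
open import Data.List.Relation.Unary.Any using (here; there)
open import Data.Nat.Base as ℕ using (ℕ; zero; suc; _≤_; _<_; z≤n; s≤s; ≤′-refl; ≤′-step)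
import Data.Nat.Divisibility as ℕ
open import Data.Nat.Primality using (Prime; euclidsLemma; ¬prime[1])
import Data.Nat.Properties as ℕ
open import Data.Product.Base using (∃; ∃₂; _×_; _,_; proj₁; proj₂; swap)
open import Data.Sum.Base as Sum using (_⊎_; inj₁; inj₂)
open import Data.Vec.Base using ([]; _∷_)
open import Function.Base using (_∘_; id)
open import Level using (Level; 0ℓ; lift; _⊔_) renaming (suc to lsuc)
open import Relation.Binary.Construct.Add.Supremum.NonStrict ℤ._≤_ using ([_])
open import Relation.Binary.PropositionalEquality.Core as ≡ using (_≡_)
import Relation.Binary.Reasoning.Setoid
open import Relation.Nullary.Construct.Add.Supremum using ([_])
open import Relation.Nullary.Decidable.Core using (Dec; yes; no; decidable-stable)
open import Relation.Nullary.Negation.Core using (¬_; contradiction)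
open import Relation.Unary using (Pred; _⊆_)

module ℕ+ = Algebra.Properties.CommutativeSemigroup ℕ.+-commutativeSemigroup
module ℤ-Solver = Data.Integer.Solver.+-*-Solver

-- Directed families on ultrametric trees

-- `a ~[ n ] b` stands for v(a - b) ≥ n. This abstraction treats the rings of integers of both kinds
-- of field at once.
record UltrametricTree (x r : Level) : Set (lsuc (x ⊔ r)) where
  infix 4 _~[_]_
  field
    Point    : Set x
    origin   : Point
    _~[_]_   : Point → ℕ → Point → Set r
    ~-refl   : ∀ {n a} → a ~[ n ] a
    ~-sym    : ∀ {n a b} → a ~[ n ] b → b ~[ n ] a
    ~-trans  : ∀ {n a b c} → a ~[ n ] b → b ~[ n ] c → a ~[ n ] c
    ~-weaken : ∀ {n a b} → a ~[ suc n ] b → a ~[ n ] b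
    perfect  : ∀ a n → ∃ λ b → b ~[ n ] a × ¬ b ~[ suc n ] a
    complete : ∀ (s : ℕ → Point) → (∀ n → s (suc n) ~[ n ] s n) →
               ∃ λ a → ∀ n → a ~[ n ] s n

Agree : ∀ {x p} {X : Set x} → Pred X p → X → X → Set p
Agree P u v = (P u → P v) × (P v → P u)

Constant : ∀ {x p q} {X : Set x} → Pred X p → Pred X q → Set (x ⊔ p ⊔ q)
Constant P Q = ∀ {u v} → Q u → Q v → P u → P v

module Balls {x r} (T : UltrametricTree x r) where
  open UltrametricTree T

  ~-weaken* : ∀ {m n a b} → m ≤ n → a ~[ n ] b → a ~[ m ] b
  ~-weaken* m≤n = go (ℕ.≤⇒≤′ m≤n)
    where
    go : ∀ {m n a b} → m ℕ.≤′ n → a ~[ n ] b → a ~[ m ] b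
    go ≤′-refl     = id
    go (≤′-step p) = go p ∘ ~-weaken

  Exact : Point → Point → ℕ → Set r
  Exact a y n = y ~[ n ] a × ¬ y ~[ suc n ] a

  exact-near : ∀ {a y z n} → Exact a z n → y ~[ suc n ] z → Exact a y n
  exact-near (z~a , z≁a) y~z =
    ~-trans (~-weaken y~z) z~a , λ y~a → z≁a (~-trans (~-sym y~z) y~a)

  exact-recentre : ∀ {a b y n} → Exact a y n → b ~[ suc n ] a → Exact b y n
  exact-recentre (y~a , y≁a) b~a =
    ~-trans y~a (~-sym (~-weaken b~a)) , λ y~b → y≁a (~-trans y~b b~a)

  -- Every triangle is isosceles: `y` is nearer to `a` than `b` is, so `b` sees `y` at the distance
  -- of `a`.
  exact-swap : ∀ {a b y n} → Exact a b n → y ~[ suc n ] a → Exact b y n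
  exact-swap (b~a , b≁a) y~a =
    ~-trans (~-weaken y~a) (~-sym b~a) , λ y~b → b≁a (~-trans (~-sym y~b) y~a)

  Ball : Set x
  Ball = Point × ℕ

  infix 4 _∈ᵇ_ _⊑_
  _∈ᵇ_ : Point → Ball → Set r
  a ∈ᵇ (c , n) = a ~[ n ] c

  -- Inclusion is recorded through centres and exponents, so that the growth of exponents can be
  -- read off when a limit is built.
  _⊑_ : Ball → Ball → Set r
  (c , m) ⊑ (d , n) = n ≤ m × c ~[ n ] d

  ⊑⇒⊆ : ∀ {U B a} → U ⊑ B → a ∈ᵇ U → a ∈ᵇ B
  ⊑⇒⊆ (n≤m , c~d) a~c = ~-trans (~-weaken* n≤m a~c) c~d

  ⊑-refl : ∀ {B} → B ⊑ B
  ⊑-refl = ℕ.≤-refl , ~-refl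

  ⊑-trans : ∀ {U V B} → U ⊑ V → V ⊑ B → U ⊑ B
  ⊑-trans {U} {V} {B} (n≤m , c~d) V⊑B@(k≤n , _) =
    ℕ.≤-trans k≤n n≤m , ⊑⇒⊆ {V} {B} V⊑B c~d

  Dense : ∀ {p} → Pred Point p → Ball → Set (x ⊔ r ⊔ p)
  Dense C B = ∀ {U} → U ⊑ B → ∃ λ a → C a × a ∈ᵇ U

  Dense-⊑ : ∀ {p U B} {C : Pred Point p} → U ⊑ B → Dense C B → Dense C U
  Dense-⊑ {U = U} {B} U⊑B dense {V} V⊑U = dense (⊑-trans {V} {U} {B} V⊑U U⊑B)

-- Centres whose sets are determined by boundedly many members of a directed family

module DirectedFamily
  (em : ∀ {a : Level} → ExcludedMiddle a)
  {x e i : Level} (T : UltrametricTree x e)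
  {I : Set i} (𝓑 : I → Pred (UltrametricTree.Point T) e) (directed : Directed 𝓑)
  {J : Set} (χ : J → Pred (UltrametricTree.Point T) e)
  (S : UltrametricTree.Point T → Pred (UltrametricTree.Point T) e)
  (alternates : ∀ {a y z n} → Balls.Exact T a y n → Balls.Exact T a z (suc n) → ¬ Agree (S a) y z)
  where

  open UltrametricTree T
  open Balls T

  dne : ∀ {a} {P : Set a} → ¬ ¬ P → P
  dne = decidable-stable em

  ℓ₀ : Level
  ℓ₀ = x ⊔ e ⊔ i

  Avoids : ∀ {p} → Pred Point p → Ball → Set (x ⊔ e ⊔ p)
  Avoids C U = ∀ {a} → a ∈ᵇ U → ¬ C a

  ¬Dense⇒avoids : ∀ {p B} {C : Pred Point p} → ¬ Dense C B → ∃ λ U → U ⊑ B × Avoids C U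
  ¬Dense⇒avoids {p} {B} {C} ¬dense = dne {P = ∃ λ U → U ⊑ B × Avoids C U} λ no-ball →
    ¬dense (λ {U} U⊑B → dne (no-point no-ball U⊑B))
    where
    no-point : ¬ (∃ λ U → U ⊑ B × Avoids C U) → ∀ {U} → U ⊑ B → ¬ ¬ (∃ λ a → C a × a ∈ᵇ U)
    no-point no-ball U⊑B empty = no-ball (_ , U⊑B , λ a∈U c → empty (_ , c , a∈U))

  -- On Q, P is a union of atoms of the algebra generated by at most N members of 𝓑.
  Determined : ℕ → Pred Point ℓ₀ → Pred Point e → Set ℓ₀
  Determined N Q P = ∃ λ n → n ≤ N × ∃ λ (Ds : Fin n → I) →
    ∀ {u v} → Q u → Q v → (∀ j → Agree (𝓑 (Ds j)) u v) → P u → P v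

  discard : ∀ {N P Q n} → n ≤ suc N → (Ds : Fin n → I) →
            (∀ {u v} → Q u → Q v → (∀ j → Agree (𝓑 (Ds j)) u v) → P u → P v) →
            ∀ j → Constant (𝓑 (Ds j)) Q → Determined N Q P
  discard (s≤s n≤N) Ds det j const = _ , n≤N , Ds ∘ punchIn j , λ {u} {v} qu qv agree →
    det qu qv λ k → agree-at k qu qv agree
    where
    agree-at : ∀ k {u v} → _ → _ → (∀ k′ → Agree (𝓑 (Ds (punchIn j k′))) u v) → Agree (𝓑 (Ds k)) u v
    agree-at k {u} {v} qu qv agree with j Fin.≟ k
    ... | yes ≡.refl = const qu qv , const qv qu
    ... | no  j≢k  = ≡.subst (λ k′ → Agree (𝓑 (Ds k′)) u v) (Fin.punchIn-punchOut j≢k) (agree (punchOut j≢k))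

  -- A record, so that C and B can be inferred from C ↾ B.
  infixl 7 _↾_
  record _↾_ (C : Pred Point ℓ₀) (B : Ball) (a : Point) : Set ℓ₀ where
    constructor _,_
    field
      ↾-pred : C a
      ↾-ball : a ∈ᵇ B

  ↾-mono : ∀ {U B} {C C′ : Pred Point ℓ₀} → C′ ⊆ C → U ⊑ B → C′ ↾ U ⊆ C ↾ B
  ↾-mono {U} {B} sub U⊑B (c , a∈U) = sub c , ⊑⇒⊆ {U} {B} U⊑B a∈U

  -- `A` holds the centres `a` and `C` the test points. The two are kept apart because the
  -- refinements below thin out the test points without always touching the centres.
  record Configuration (N : ℕ) (B : Ball) : Set (lsuc ℓ₀) where
    field
      {A C}      : Pred Point ℓ₀
      A-dense    : Dense A B
      C-dense    : Dense C B
      determined : ∀ {a} → A a → a ∈ᵇ B → Determined N (C ↾ B) (S a)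

  module Extremal {N B} (K : Configuration N B) where
    open Configuration K

    Resolves : Set _
    Resolves = ∀ {n U} → n ≤ N → (Ds : Fin n → I) → U ⊑ B →
      ∃ λ V → V ⊑ U × (∀ j → Constant (𝓑 (Ds j)) (C ↾ V))

    -- The list must determine `S b` on all of `C ↾ B`, while non-constancy is asked on `C ↾ U`: it
    -- will be applied to two points of `B` outside `U`.
    EssentialOn : Ball → Set _
    EssentialOn U = ∃ λ b → b ∈ᵇ U × ∃ λ n → ∃ λ (Ds : Fin n → I) →
      (∀ {u v} → (C ↾ B) u → (C ↾ B) v → (∀ j → Agree (𝓑 (Ds j)) u v) → S b u → S b v) ×
      (∀ j → ¬ Constant (𝓑 (Ds j)) (C ↾ U))

    Essential : Set _
    Essential = ∀ {U} → U ⊑ B → EssentialOn U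

    -- If `𝓑 i` contains `w`, it contains `C ↾ V`, so a `𝓑 j` splitting `C ↾ V` can only lie inside
    -- `𝓑 i` and misses `y`. If `𝓑 i` omits `w`, it misses `C ↾ V` and contains `y` and `y′`; then
    -- `𝓑 j`, which meets both `C ↾ V` and `𝓑 i`, can only contain `𝓑 i`.
    not-separated : ∀ {V i j w y y′} → Constant (𝓑 i) (C ↾ V) → ¬ Constant (𝓑 j) (C ↾ V) →
                    (C ↾ V) w → ¬ Agree (𝓑 i) w y → Agree (𝓑 i) y y′ → 𝓑 j y → 𝓑 j y′
    not-separated {V} {i} {j} {w} {y} {y′} const-i ¬const-j w∈ w≁y (y⇒y′ , y′⇒y) jy
      with em {P = 𝓑 i w} | em {P = 𝓑 i y}
    ... | yes iw | yes iy = contradiction ((λ _ → iy) , (λ _ → iw)) w≁y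
    ... | no ¬iw | no ¬iy = contradiction ((λ iw → contradiction iw ¬iw) , (λ iy → contradiction iy ¬iy)) w≁y
    ... | yes iw | no ¬iy with directed i j
    ...   | inj₁ i⊆j = ⊥-elim (¬const-j λ _ v∈ _ → i⊆j (const-i w∈ v∈ iw))
    ...   | inj₂ (inj₁ j⊆i) = contradiction (j⊆i jy) ¬iy
    ...   | inj₂ (inj₂ disj) = ⊥-elim (¬const-j λ u∈ _ ju → ⊥-elim (disj (const-i w∈ u∈ iw , ju)))
    not-separated {V} {i} {j} {w} {y} {y′} const-i ¬const-j w∈ w≁y (y⇒y′ , y′⇒y) jy
        | no ¬iw | yes iy with directed i j
    ...   | inj₁ i⊆j = i⊆j (y⇒y′ iy)
    ...   | inj₂ (inj₁ j⊆i) = ⊥-elim (¬const-j λ u∈ _ ju → ⊥-elim (¬iw (const-i u∈ w∈ (j⊆i ju))))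
    ...   | inj₂ (inj₂ disj) = ⊥-elim (disj (iy , jy))

    impossible : Resolves → Essential → ⊥
    impossible resolves essential with A-dense (⊑-refl {B})
    ... | a , Aa , a∈B with determined Aa a∈B
    ...   | n , n≤N , Ds , det = conclusion
      where
      r₀ = proj₂ B

      -- By `exact-near`, the whole ball of exponent `suc k` about `z` lies on the sphere v(z - a) =
      -- k.
      annulus : ∀ k → r₀ ≤ k → ∃ λ z → Exact a z k × (z , suc k) ⊑ B
      annulus k r₀≤k with perfect a k
      ... | z , ex = z , ex , ℕ.m≤n⇒m≤1+n r₀≤k , ~-trans (~-weaken* r₀≤k (proj₁ ex)) a∈B

      -- The shift by `r₀` keeps the spheres inside `B`. The factor 2 leaves a free sphere between
      -- any two sampled ones, where `b` will be placed.
      index : ℕ → ℕ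
      index k = k ℕ.* 2 ℕ.+ r₀

      r₀≤index : ∀ k → r₀ ≤ index k
      r₀≤index k = ℕ.m≤n+m r₀ (k ℕ.* 2)

      sample : ∀ k → ∃ λ y → (C ↾ B) y × Exact a y (index k)
      sample k with annulus (index k) (r₀≤index k)
      ... | z , ex , sub with C-dense sub
      ...   | y , Cy , y∈ = y , (Cy , ⊑⇒⊆ {z , _} {B} sub y∈) , exact-near ex y∈

      y : ℕ → Point
      y k = proj₁ (sample k)

      bit : ∀ {P : Set e} → Dec P → Fin 2
      bit (yes _) = zero
      bit (no _)  = suc zero

      bit-agree : ∀ {P Q : Set e} (p : Dec P) (q : Dec Q) → bit p ≡ bit q → P → Q
      bit-agree _       (yes q) _ _ = q
      bit-agree (no ¬p) (no _)  _ p = contradiction p ¬p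

      bits : ℕ → Fin n → Fin 2
      bits k j = bit (em {P = 𝓑 (Ds j) (y k)})

      -- The `n` members allow at most 2ⁿ membership patterns, so 2ⁿ + 1 samples contain a
      -- repetition.
      same-atom : ∃₂ λ k k′ → suc k ≤ k′ × (∀ j → Agree (𝓑 (Ds j)) (y k) (y k′))
      same-atom with Fin.pigeonhole {n = suc (2 ℕ.^ n)} ℕ.≤-refl (λ k → funToFin (bits (toℕ k)))
      ... | k , k′ , k<k′ , eq = toℕ k , toℕ k′ , k<k′ , λ j →
            bit-agree em em (bits≡ j) , bit-agree em em (≡.sym (bits≡ j))
        where
        bits≡ : ∀ j → bits (toℕ k) j ≡ bits (toℕ k′) j
        bits≡ j = ≡.trans (≡.sym (Fin.finToFun-funToFin (bits (toℕ k)) j))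
          (≡.trans (≡.cong (λ f → finToFun f j) eq) (Fin.finToFun-funToFin (bits (toℕ k′)) j))

      conclusion : ⊥
      conclusion with same-atom
      ... | k , k′ , k<k′ , agree
        with annulus (suc (index k)) (ℕ.m≤n⇒m≤1+n (r₀≤index k))
      ...   | z , exz , U⊑B
        with resolves n≤N Ds U⊑B
      ...     | V , V⊑U , const
        with essential (⊑-trans {V} {z , _} {B} V⊑U U⊑B) | C-dense (⊑-trans {V} {z , _} {B} V⊑U U⊑B)
      ...       | b , b∈V , n′ , Ds′ , det′ , ¬const | w , Cw , w∈V = alternates exb exb′
          ( det′ yₖ∈ yₖ′∈ agree′
          , det′ yₖ′∈ yₖ∈ (swap ∘ agree′))
        where
        yₖ  = y k
        yₖ′ = y k′
        yₖ∈  = proj₁ (proj₂ (sample k))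
        yₖ′∈ = proj₁ (proj₂ (sample k′))
        ex   = proj₂ (proj₂ (sample k))
        ex′  = proj₂ (proj₂ (sample k′))
        w∈U : w ~[ suc (suc (index k)) ] z
        w∈U = ⊑⇒⊆ {V} {z , _} V⊑U w∈V
        exw : Exact a w (suc (index k))
        exw = exact-near exz w∈U
        ex-b : Exact a b (suc (index k))
        ex-b = exact-near exz (⊑⇒⊆ {V} {z , _} V⊑U b∈V)
        exb : Exact b yₖ (index k)
        exb = exact-recentre ex (proj₁ ex-b)
        -- `yₖ′` is nearer to `a` than `b` is: `index (suc k)` computes to `suc (suc (index k))`,
        -- and `k′` is at least `suc k`.
        exb′ : Exact b yₖ′ (suc (index k))
        exb′ = exact-swap ex-b (~-weaken* (ℕ.+-monoˡ-≤ r₀ (ℕ.*-monoˡ-≤ 2 k<k′)) (proj₁ ex′))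
        -- `yₖ` and `w` lie on consecutive spheres about `a`, so `S a` tells them apart, and hence
        -- so does some member of `a`.
        separating : ∃ λ j → ¬ Agree (𝓑 (Ds j)) w yₖ
        separating = dne λ none → alternates ex exw
          (let agree-all : ∀ j → Agree (𝓑 (Ds j)) w yₖ
               agree-all j = dne λ ¬agree → none (j , ¬agree)
               w∈B = Cw , ⊑⇒⊆ {z , _} {B} U⊑B w∈U
           in det yₖ∈ w∈B (swap ∘ agree-all)
            , det w∈B yₖ∈ agree-all)
        agree′ : ∀ j → Agree (𝓑 (Ds′ j)) yₖ yₖ′
        agree′ j with separating
        ... | s , w≁y =
            not-separated {V} (const s) (¬const j) (Cw , w∈V) w≁y (agree s)
          , not-separated {V} (const s) (¬const j) (Cw , w∈V) w≁y′ (swap (agree s))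
          where
          w≁y′ : ¬ Agree (𝓑 (Ds s)) w yₖ′
          w≁y′ (p , q) = w≁y (proj₂ (agree s) ∘ p , q ∘ proj₁ (agree s))

  resolve-all : ∀ {B C} → (∀ i {U} → U ⊑ B → ∃ λ V → V ⊑ U × Constant (𝓑 i) (C ↾ V)) →
    ∀ {n U} (Ds : Fin n → I) → U ⊑ B → ∃ λ V → V ⊑ U × (∀ j → Constant (𝓑 (Ds j)) (C ↾ V))
  resolve-all _ {zero} {U} Ds U⊑B = U , ⊑-refl {U} , λ ()
  resolve-all {B} resolve {suc n} {U} Ds U⊑B with resolve (Ds zero) U⊑B
  ... | V , V⊑U , const with resolve-all {B} resolve (Ds ∘ suc) (⊑-trans {V} {U} {B} V⊑U U⊑B)
  ...   | W , W⊑V , consts = W , ⊑-trans {W} {V} {U} W⊑V V⊑U , λ where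
            zero    u∈ v∈ → const (↾-mono {W} {V} id W⊑V u∈) (↾-mono {W} {V} id W⊑V v∈)
            (suc j) → consts j

  -- Induction on `N` replaces the choice of a minimal `N`: if `Resolves` or `Essential` failed,
  -- there would be a configuration for the predecessor. For `N` zero all lists are empty and both
  -- hold vacuously.
  no-configuration : ∀ N {B} → ¬ Configuration N B
  no-configuration zero {B} K = Extremal.impossible K
      (λ { {U = U} z≤n Ds U⊑B → U , ⊑-refl {U} , λ () })
      essential
    where
    open Configuration K
    essential : Extremal.Essential K
    essential {U} U⊑B with A-dense U⊑B
    ... | b , Ab , b∈U with determined Ab (⊑⇒⊆ {U} {B} U⊑B b∈U)
    ...   | zero , z≤n , Ds , det = b , b∈U , 0 , Ds , det , λ ()
  no-configuration (suc N) {B} K = Extremal.impossible K (λ _ → resolve-all {B} resolve) essential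
    where
    open Configuration K

    essential : Extremal.Essential K
    -- If `U` has no essential point, then the list of every centre in `U` has a member constant on
    -- `C ↾ U`, and discarding it gives a smaller configuration on `U`.
    essential {U} U⊑B = dne λ none → no-configuration N {U} record
      { A-dense    = Dense-⊑ {U = U} {B} U⊑B A-dense
      ; C-dense    = Dense-⊑ {U = U} {B} U⊑B C-dense
      ; determined = λ Aa a∈U → reduce none a∈U (determined Aa (⊑⇒⊆ {U} {B} U⊑B a∈U))
      }
      where
      reduce : ∀ {a} → ¬ Extremal.EssentialOn K U → a ∈ᵇ U →
               Determined (suc N) (C ↾ B) (S a) → Determined N (C ↾ U) (S a)
      reduce none a∈U (n , n≤ , Ds , det) with em {P = ∃ λ j → Constant (𝓑 (Ds j)) (C ↾ U)}
      ... | yes (j , const) = discard n≤ Ds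
              (λ u v → det (↾-mono {U} {B} id U⊑B u) (↾-mono {U} {B} id U⊑B v)) j const
      ... | no ¬const = ⊥-elim
              (none (_ , a∈U , n , Ds , det , λ j const → ¬const (j , const)))

    -- If 𝓑 i and its complement were both dense in C, then the first member of each list,
    -- being comparable to or disjoint from 𝓑 i, would be redundant on one of the two sides.
    resolve : ∀ i {U} → U ⊑ B → ∃ λ V → V ⊑ U × Constant (𝓑 i) (C ↾ V)
    resolve i {U} U⊑B = dne λ none → unresolved none
      where
      C₁ C₂ A₁ : Pred Point ℓ₀
      C₁ a = C a × 𝓑 i a
      C₂ a = C a × ¬ 𝓑 i a
      -- The centres that lose a member inside `𝓑 i`. If they are dense in `U`, they form a smaller
      -- configuration with `C₁`; otherwise they miss a ball `V`, on which every centre loses a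
      -- member outside `𝓑 i`.
      A₁ a = A a × Determined N (C₁ ↾ U) (S a)

      module _ (none : ¬ ∃ λ V → V ⊑ U × Constant (𝓑 i) (C ↾ V)) where
        -- On a ball without points of `C₁`, `𝓑 i` would be constantly false on `C`; on one without
        -- points of `C₂`, constantly true.
        C₁-dense : Dense C₁ U
        C₁-dense {V} V⊑U = dne λ empty → none (V , V⊑U , λ (Cu , u∈V) _ iu →
          contradiction (_ , (Cu , iu) , u∈V) empty)

        C₂-dense : Dense C₂ U
        C₂-dense {V} V⊑U = dne λ empty → none (V , V⊑U , λ _ (Cv , v∈V) _ →
          dne λ ¬iv → empty (_ , (Cv , ¬iv) , v∈V))

        side : ∀ {a V} → V ⊑ U → Determined (suc N) (C ↾ B) (S a) →
               Determined N (C₁ ↾ U) (S a) ⊎ Determined N (C₂ ↾ V) (S a)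
        -- An empty list already meets the bound `N`; it is assigned to the first side by default.
        side {a} {V} V⊑U (zero , _ , Ds , det) = inj₁ (zero , z≤n , Ds , λ u v →
          det (↾-mono {U} {B} proj₁ U⊑B u) (↾-mono {U} {B} proj₁ U⊑B v))
        side {a} {V} V⊑U (suc n , n≤ , Ds , det) with directed i (Ds zero)
        ... | inj₁ i⊆D = inj₁ (discard n≤ Ds
                (λ u v → det (↾-mono {U} {B} proj₁ U⊑B u) (↾-mono {U} {B} proj₁ U⊑B v))
                zero λ _ ((_ , iv) , _) _ → i⊆D iv)
        ... | inj₂ (inj₂ disj) = inj₁ (discard n≤ Ds
                (λ u v → det (↾-mono {U} {B} proj₁ U⊑B u) (↾-mono {U} {B} proj₁ U⊑B v))
                zero λ ((_ , iu) , _) _ Du → ⊥-elim (disj (iu , Du)))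
        ... | inj₂ (inj₁ D⊆i) = inj₂ (discard n≤ Ds (λ u v → det (widen u) (widen v))
                zero λ ((_ , ¬iu) , _) _ Du → contradiction (D⊆i Du) ¬iu)
          where
          widen : C₂ ↾ V ⊆ C ↾ B
          widen = ↾-mono {V} {B} proj₁ (⊑-trans {V} {U} {B} V⊑U U⊑B)

        unresolved : ⊥
        unresolved with em {P = Dense A₁ U}
        ... | yes A₁-dense = no-configuration N {U} record
          { A-dense = A₁-dense ; C-dense = C₁-dense ; determined = λ (_ , det) _ → det }
        ... | no ¬A₁-dense with ¬Dense⇒avoids ¬A₁-dense
        ...   | V , V⊑U , avoids = no-configuration N {V} record
          { A-dense    = Dense-⊑ {U = V} {B} (⊑-trans {V} {U} {B} V⊑U U⊑B) A-dense
          ; C-dense    = Dense-⊑ {U = V} {U} V⊑U C₂-dense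
          ; determined = determined′
          }
          where
          determined′ : ∀ {a} → A a → a ∈ᵇ V → Determined N (C₂ ↾ V) (S a)
          determined′ Aa a∈V with side V⊑U (determined Aa (⊑⇒⊆ {V} {B} (⊑-trans {V} {U} {B} V⊑U U⊑B) a∈V))
          ... | inj₁ det = contradiction (Aa , det) (avoids a∈V)
          ... | inj₂ det = det

  -- Either the points of `C` satisfying `χ j` are dense and replace `C`, or they miss a ball, on
  -- which `χ j` is false throughout `C`.
  refine : ∀ {B} {C : Pred Point ℓ₀} (js : List J) → Dense C B →
    ∃ λ V → V ⊑ B × ∃ λ (C′ : Pred Point ℓ₀) → Dense C′ V × All (λ j → Constant (χ j) (C′ ↾ V)) js × C′ ⊆ C
  refine {B} {C} [] dense = B , ⊑-refl {B} , C , dense , [] , id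
  refine {B} {C} (j ∷ js) dense with em {P = Dense C₁ B}
    where
    C₁ : Pred Point ℓ₀
    C₁ a = C a × χ j a
  ... | yes C₁-dense with refine js C₁-dense
  ...   | V , V⊑B , C′ , C′-dense , consts , C′⊆C₁ =
          V , V⊑B , C′ , C′-dense , (λ _ (C′v , _) _ → proj₂ (C′⊆C₁ C′v)) ∷ consts , proj₁ ∘ C′⊆C₁
  refine {B} {C} (j ∷ js) dense | no ¬C₁-dense with ¬Dense⇒avoids ¬C₁-dense
  ...   | U , U⊑B , avoids with refine js (Dense-⊑ {U = U} {B} U⊑B dense)
  ...     | V , V⊑U , C′ , C′-dense , consts , C′⊆C =
            V , ⊑-trans {V} {U} {B} V⊑U U⊑B , C′ , C′-dense
          , (λ (C′u , u∈V) _ Pu → contradiction (C′⊆C C′u , Pu) (avoids (⊑⇒⊆ {V} {U} V⊑U u∈V))) ∷ consts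
          , C′⊆C

  -- Baire category

  DeterminedOver : (ℕ → List J) → ℕ → Pred Point e → Set ℓ₀
  DeterminedOver Φ m P = ∃ λ n → n ≤ m × ∃ λ (Ds : Fin n → I) →
    ∀ {u v} → All (λ j → Agree (χ j) u v) (Φ m) → (∀ j → Agree (𝓑 (Ds j)) u v) → P u → P v

  -- Once the predicates in `Φ m` are constant on the test points, only members of the family can
  -- separate these, which gives a configuration. A single `m` bounds both `Φ` and the number of
  -- members, so the stages form a sequence.
  nowhere-dense : ∀ Φ m B → ∃ λ V → V ⊑ B × Avoids (λ a → DeterminedOver Φ m (S a)) V
  nowhere-dense Φ m B = ¬Dense⇒avoids λ dense →
    -- The dense set of centres also serves as the initial set of test points.
    let V , V⊑B , C , C-dense , consts , _ = refine {B} {λ a → DeterminedOver Φ m (S a)} (Φ m) dense in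
    no-configuration m {V} record
      { A-dense    = Dense-⊑ {U = V} {B} V⊑B dense
      ; C-dense    = C-dense
      ; determined = λ (n , n≤m , Ds , det) _ → n , n≤m , Ds , λ u v →
          det (All.map (λ const → const u v , const v u) consts)
      }

  not-all-determined : ∀ Φ → ¬ (∀ a → ∃ λ m → DeterminedOver Φ m (S a))
  not-all-determined Φ all-det =
    contradiction (proj₂ (all-det limit)) (undetermined (proj₁ (all-det limit)))
    where
    ball : ℕ → Ball
    avoiding : ℕ → Ball

    avoiding m = proj₁ (nowhere-dense Φ m (ball m))
    ball zero    = origin , 0
    -- Raising the exponent by one makes the balls shrink, so that their centres converge.
    ball (suc m) = proj₁ (avoiding m) , suc (proj₂ (avoiding m))

    next⊑avoiding : ∀ m → ball (suc m) ⊑ avoiding m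
    next⊑avoiding m = ℕ.n≤1+n _ , ~-refl

    avoiding⊑ : ∀ m → avoiding m ⊑ ball m
    avoiding⊑ m = proj₁ (proj₂ (nowhere-dense Φ m (ball m)))

    next⊑ : ∀ m → ball (suc m) ⊑ ball m
    next⊑ m = ⊑-trans {ball (suc m)} {avoiding m} {ball m} (next⊑avoiding m) (avoiding⊑ m)

    radius≥ : ∀ m → m ≤ proj₂ (ball m)
    radius≥ zero    = z≤n
    radius≥ (suc m) = s≤s (ℕ.≤-trans (radius≥ m) (proj₁ (avoiding⊑ m)))

    nested : ∀ {m n} → m ℕ.≤′ n → ball n ⊑ ball m
    nested {m} ≤′-refl = ⊑-refl {ball m}
    nested {m} {suc n} (≤′-step p) = ⊑-trans {ball (suc n)} {ball n} {ball m} (next⊑ n) (nested p)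

    converges : ∃ λ a → ∀ n → a ~[ n ] proj₁ (ball n)
    converges = complete (proj₁ ∘ ball) λ n → ~-weaken* (radius≥ n) (proj₂ (next⊑ n))

    limit : Point
    limit = proj₁ converges

    limit∈ : ∀ m → limit ∈ᵇ ball m
    -- With r the exponent of `ball m`, the limit agrees to precision r with the centre of `ball r`,
    -- and m ≤ r puts `ball r` inside `ball m`.
    limit∈ m = ~-trans (proj₂ converges (proj₂ (ball m))) (proj₂ (nested (ℕ.≤⇒≤′ (radius≥ m))))

    undetermined : ∀ m → ¬ DeterminedOver Φ m (S limit)
    undetermined m = proj₂ (proj₂ (nowhere-dense Φ m (ball m)))
      (⊑⇒⊆ {ball (suc m)} {avoiding m} (next⊑avoiding m) (limit∈ (suc m)))

-- Formulas of the language

Eventually : ∀ {p} → (ℕ → Set p) → Set p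
Eventually P = ∃ λ m₀ → ∀ {m} → m₀ ≤ m → P m

eventually-suc : ∀ {p q} {P : ℕ → Set p} {Q : ℕ → Set q} →
                 (∀ {m} → P m → Q (suc m)) → Eventually P → Eventually Q
eventually-suc f (m₀ , p) = suc m₀ , λ { (s≤s m₀≤m) → f (p m₀≤m) }

eventually-× : ∀ {p q} {P : ℕ → Set p} {Q : ℕ → Set q} →
               Eventually P → Eventually Q → Eventually (λ m → P m × Q m)
eventually-× (m₀ , p) (m₁ , q) = m₀ ℕ.⊔ m₁ , λ le →
  p (ℕ.≤-trans (ℕ.m≤m⊔n m₀ m₁) le) , q (ℕ.≤-trans (ℕ.m≤n⊔m m₀ m₁) le)

binary : ∀ {n} → DivFunction 2 → Term Lᵈⁱᵛ n → Term Lᵈⁱᵛ n → Term Lᵈⁱᵛ n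
binary f s t = app f (s ∷ t ∷ [])

divides′ : ∀ {n} → Term Lᵈⁱᵛ n → Term Lᵈⁱᵛ n → Formula Lᵈⁱᵛ n
divides′ s t = rel div (s ∷ t ∷ [])

terms : ∀ n → ℕ → List (Term Lᵈⁱᵛ n)
terms n zero    = []
terms n (suc m) = map var (allFin n)
               ++ cartesianProductWith (binary plus) (terms n m) (terms n m)
               ++ cartesianProductWith (binary times) (terms n m) (terms n m)

-- Finite stages exhausting the countably many formulas; `formulas 1` supplies the lists `Φ` of the
-- category argument.
formulas : ∀ n → ℕ → List (Formula Lᵈⁱᵛ n)
formulas n zero    = []
formulas n (suc m) = ⊥′ ∷ cartesianProductWith _≈′_ (terms n m) (terms n m)
                  ++ cartesianProductWith divides′ (terms n m) (terms n m)
                  ++ cartesianProductWith _⇒′_ (formulas n m) (formulas n m)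
                  ++ map ∀′ (formulas (suc n) m)

terms-complete : ∀ {n} (t : Term Lᵈⁱᵛ n) → Eventually λ m → t ∈ terms n m
terms-complete (var i) = 1 , λ { (s≤s _) → ∈-++⁺ˡ (∈-map⁺ var (∈-allFin i)) }
terms-complete {n} (app plus (s ∷ t ∷ [])) = eventually-suc
  (λ (s∈ , t∈) → ∈-++⁺ʳ (map var (allFin n)) (∈-++⁺ˡ (∈-cartesianProductWith⁺ (binary plus) s∈ t∈)))
  (eventually-× (terms-complete s) (terms-complete t))
terms-complete {n} (app times (s ∷ t ∷ [])) = eventually-suc
  (λ {m} (s∈ , t∈) → ∈-++⁺ʳ (map var (allFin n))
    (∈-++⁺ʳ (cartesianProductWith (binary plus) (terms n m) (terms n m))
    (∈-cartesianProductWith⁺ (binary times) s∈ t∈)))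
  (eventually-× (terms-complete s) (terms-complete t))

formulas-complete : ∀ {n} (φ : Formula Lᵈⁱᵛ n) → Eventually λ m → φ ∈ formulas n m
formulas-complete ⊥′ = 1 , λ { (s≤s _) → here ≡.refl }
formulas-complete (s ≈′ t) = eventually-suc
  (λ (s∈ , t∈) → there (∈-++⁺ˡ (∈-cartesianProductWith⁺ _≈′_ s∈ t∈)))
  (eventually-× (terms-complete s) (terms-complete t))
formulas-complete {n} (rel div (s ∷ t ∷ [])) = eventually-suc
  (λ {m} (s∈ , t∈) → there (∈-++⁺ʳ (cartesianProductWith _≈′_ (terms n m) (terms n m))
    (∈-++⁺ˡ (∈-cartesianProductWith⁺ divides′ s∈ t∈))))
  (eventually-× (terms-complete s) (terms-complete t))
formulas-complete {n} (φ ⇒′ ψ) = eventually-suc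
  (λ {m} (φ∈ , ψ∈) → there (∈-++⁺ʳ (cartesianProductWith _≈′_ (terms n m) (terms n m))
    (∈-++⁺ʳ (cartesianProductWith divides′ (terms n m) (terms n m))
    (∈-++⁺ˡ (∈-cartesianProductWith⁺ _⇒′_ φ∈ ψ∈)))))
  (eventually-× (formulas-complete φ) (formulas-complete ψ))
formulas-complete {n} (∀′ φ) = eventually-suc
  (λ {m} φ∈ → there (∈-++⁺ʳ (cartesianProductWith _≈′_ (terms n m) (terms n m))
    (∈-++⁺ʳ (cartesianProductWith divides′ (terms n m) (terms n m))
    (∈-++⁺ʳ (cartesianProductWith _⇒′_ (formulas n m) (formulas n m))
    (∈-map⁺ ∀′ φ∈)))))
  (formulas-complete φ)

-- "v(x − a) is even", with x variable zero and a variable one: some w and z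
-- satisfy w + a = x and v(w) = v(z²), where z ∣ z says that z has a valuation.
evenDistance : Formula Lᵈⁱᵛ 2
evenDistance = ∀′ (∀′ (binary plus w a ≈′ x ⇒′ divides′ z z ⇒′
                       divides′ (binary times z z) w ⇒′ divides′ w (binary times z z) ⇒′ ⊥′)) ⇒′ ⊥′
  where
  w z x a : Term Lᵈⁱᵛ 4
  w = var zero
  z = var (suc zero)
  x = var (suc (suc zero))
  a = var (suc (suc (suc zero)))

-- Parity, and integers as differences of natural numbers

parity : ∀ n → (∃ λ m → n ≡ 2 ℕ.* m) ⊎ (∃ λ m → suc n ≡ 2 ℕ.* m)
parity zero    = inj₁ (0 , ≡.refl)
parity (suc n) with parity n
... | inj₁ (m , n≡2m)  = inj₂ (suc m , ≡.trans (≡.cong (2 ℕ.+_) n≡2m) (≡.sym (ℕ.*-suc 2 m)))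
... | inj₂ (m , 1+n≡2m) = inj₁ (m , 1+n≡2m)

⊖-cong-+ : ∀ p q p′ q′ → p ℕ.+ q′ ≡ p′ ℕ.+ q → p ℤ.⊖ q ≡ p′ ℤ.⊖ q′
⊖-cong-+ p q p′ q′ eq =
  ≡.trans (≡.sym (ℤ.+-cancelˡ-⊖ q′ p q))
    (≡.trans (≡.cong₂ ℤ._⊖_ (≡.trans (ℕ.+-comm q′ p) (≡.trans eq (ℕ.+-comm p′ q))) (ℕ.+-comm q′ q))
    (ℤ.+-cancelˡ-⊖ q p′ q′))

+≡⊖⇒+≡ : ∀ n p q → + n ≡ p ℤ.⊖ q → n ℕ.+ q ≡ p
+≡⊖⇒+≡ n p q eq = ℤ.+-injective (≡.trans (≡.cong (ℤ._+ (+ q)) eq)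
  (≡.trans (ℤ.distribˡ-⊖-+-pos q p q) (≡.trans (≡.cong (ℤ._⊖ q) (ℕ.+-comm p q))
    (≡.trans (≡.cong (q ℕ.+ p ℤ.⊖_) (≡.sym (ℕ.+-identityʳ q))) (ℤ.+-cancelˡ-⊖ q p 0)))))

positive negative : ℤ → ℕ
positive (+ n)    = n
positive -[1+ n ] = 0
negative (+ n)    = 0
negative -[1+ n ] = suc n

positive⊖negative : ∀ γ → positive γ ℤ.⊖ negative γ ≡ γ
positive⊖negative (+ n)    = ≡.refl
positive⊖negative -[1+ n ] = ≡.refl

-- Complete discrete valuation rings

record IsCompleteDVR {c ℓ} (R : CommutativeRing c ℓ) (π : CommutativeRing.Carrier R) : Set (c ⊔ ℓ) where
  open CommutativeRing R hiding (zero)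
  open Algebra.Definitions.RawMagma *-rawMagma using (_∤_)
  open Algebra.Properties.Semiring.Exp semiring using (_^_)
  field
    nonunit  : π ∤ 1#
    prime    : ∀ {u v} → π ∤ u → π ∤ v → π ∤ (u * v)
    complete : ∀ (s : ℕ → Carrier) → (∀ n → ∃ λ q → s (suc n) ≈ s n + π ^ n * q) →
               ∃ λ a → ∀ n → ∃ λ q → a ≈ s n + π ^ n * q

module CompleteDVR {c ℓ} (R : CommutativeRing c ℓ) (π : CommutativeRing.Carrier R)
  (π-cancel : Cancellable R π) (isCompleteDVR : IsCompleteDVR R π) where

  open CommutativeRing R hiding (zero)
  open IsCompleteDVR isCompleteDVR renaming (nonunit to π-nonunit; prime to π-prime)
  open Algebra.Definitions.RawMagma *-rawMagma using (_∤_; _,_)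
  open Algebra.Properties.Semiring.Exp semiring using (_^_; ^-homo-*)
  open Localisation R π π-cancel
  open Algebra.Properties.Ring ring using (-‿distribʳ-*; +-cancelˡ)
  open Algebra.Solver.Ring.NaturalCoefficients.Default commutativeSemiring
    using (solve; _:=_; _:+_; _:*_)
  open Relation.Binary.Reasoning.Setoid setoid

  infix 4 _~[_]_
  _~[_]_ : Carrier → ℕ → Carrier → Set (c ⊔ ℓ)
  a ~[ n ] b = ∃ λ q → a ≈ b + π ^ n * q

  tree : UltrametricTree c (c ⊔ ℓ)
  tree = record
    { Point    = Carrier
    ; origin   = 0#
    ; _~[_]_   = _~[_]_
    ; ~-refl   = 0# , sym (trans (+-congˡ (zeroʳ _)) (+-identityʳ _))
    ; ~-sym    = λ {n} {a} {b} (q , a≈) → - q , sym (begin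
        a + π ^ n * - q              ≈⟨ +-cong a≈ (sym (-‿distribʳ-* (π ^ n) q)) ⟩
        (b + π ^ n * q) + - (π ^ n * q) ≈⟨ +-assoc _ _ _ ⟩
        b + (π ^ n * q + - (π ^ n * q)) ≈⟨ +-congˡ (-‿inverseʳ _) ⟩
        b + 0#                       ≈⟨ +-identityʳ b ⟩
        b                            ∎)
    ; ~-trans  = λ {n} {a} {b} {d} (q , a≈) (q′ , b≈) → q′ + q , trans a≈ (trans (+-congʳ b≈)
        (solve 4 (λ d p q q′ → (d :+ p :* q′) :+ p :* q := d :+ p :* (q′ :+ q)) refl d (π ^ n) q q′))
    ; ~-weaken = λ {n} {a} {b} (q , a≈) → π * q , trans a≈
        (+-congˡ (solve 3 (λ π p q → (π :* p) :* q := p :* (π :* q)) refl π (π ^ n) q))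
    -- Were a + πⁿ within precision n + 1 of a, cancelling πⁿ would make π divide 1.
    ; perfect  = λ a n → a + π ^ n * 1# , (1# , refl) , λ (q , eq) → π-nonunit (q , sym (begin
        1#    ≈⟨ π^-cancel n (trans (+-cancelˡ a _ _ eq)
                   (solve 3 (λ π p q → (π :* p) :* q := p :* (q :* π)) refl π (π ^ n) q)) ⟩
        q * π ∎))
    ; complete = complete
    }

  open Balls tree using (Exact)

  exact-unit : ∀ {a y n} → Exact a y n → ∃ λ u → π ∤ u × y ≈ a + π ^ n * u
  exact-unit {n = n} ((u , eq) , y≁a) = u , (λ (q , qπ≈u) → y≁a (q , trans eq (+-congˡ (trans (*-congˡ (sym qπ≈u))
    (solve 3 (λ π p q → p :* (q :* π) := (π :* p) :* q) refl π (π ^ n) q))))) , eq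

  -- Common powers of π cancel; a power left over on one side would divide `u` or `v`.
  π^-unique : ∀ m n {u v} → π ∤ u → π ∤ v → π ^ m * u ≈ π ^ n * v → m ≡ n
  π^-unique zero    zero    _   _   _  = ≡.refl
  π^-unique zero    (suc n) {u} {v} π∤u _ eq = contradiction (π ^ n * v , (begin
    π ^ n * v * π   ≈⟨ solve 3 (λ π p v → p :* v :* π := (π :* p) :* v) refl π (π ^ n) v ⟩
    π * π ^ n * v   ≈⟨ eq ⟨
    1# * u          ≈⟨ *-identityˡ u ⟩
    u               ∎)) π∤u
  π^-unique (suc m) zero    π∤u π∤v eq = ≡.sym (π^-unique zero (suc m) π∤v π∤u (sym eq))
  π^-unique (suc m) (suc n) π∤u π∤v eq = ≡.cong suc (π^-unique m n π∤u π∤v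
    (π-cancel _ _ (trans (sym (*-assoc _ _ _)) (trans eq (*-assoc _ _ _)))))

  -- v(a/πᵏ) = p − q
  HasValuation : Fraction → ℕ → ℕ → Set (c ⊔ ℓ)
  HasValuation (a /π^ k) p q = ∃ λ u → π ∤ u × π ^ q * a ≈ π ^ (k ℕ.+ p) * u

  HasValuation-unique : ∀ x {p q p′ q′} → HasValuation x p q → HasValuation x p′ q′ → p ℕ.+ q′ ≡ p′ ℕ.+ q
  HasValuation-unique (a /π^ k) {p} {q} {p′} {q′} (u , π∤u , eq) (u′ , π∤u′ , eq′) =
    ℕ.+-cancelˡ-≡ k _ _ (≡.trans (shuffle k p q′) (≡.trans exponents (≡.sym (shuffle k p′ q))))
    where
    shuffle : ∀ k p q → k ℕ.+ (p ℕ.+ q) ≡ q ℕ.+ (k ℕ.+ p)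
    shuffle k p q = ≡.trans (≡.sym (ℕ.+-assoc k p q)) (ℕ.+-comm (k ℕ.+ p) q)
    exponents : q′ ℕ.+ (k ℕ.+ p) ≡ q ℕ.+ (k ℕ.+ p′)
    exponents = π^-unique _ _ π∤u π∤u′ (begin
      π ^ (q′ ℕ.+ (k ℕ.+ p)) * u        ≈⟨ *-congʳ (^-homo-* π q′ (k ℕ.+ p)) ⟩
      (π ^ q′ * π ^ (k ℕ.+ p)) * u      ≈⟨ *-assoc _ _ _ ⟩
      π ^ q′ * (π ^ (k ℕ.+ p) * u)      ≈⟨ *-congˡ eq ⟨
      π ^ q′ * (π ^ q * a)              ≈⟨ solve 3 (λ s t a → s :* (t :* a) := t :* (s :* a))
                                             refl (π ^ q′) (π ^ q) a ⟩
      π ^ q * (π ^ q′ * a)              ≈⟨ *-congˡ eq′ ⟩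
      π ^ q * (π ^ (k ℕ.+ p′) * u′)     ≈⟨ *-assoc _ _ _ ⟨
      (π ^ q * π ^ (k ℕ.+ p′)) * u′     ≈⟨ *-congʳ (^-homo-* π q (k ℕ.+ p′)) ⟨
      π ^ (q ℕ.+ (k ℕ.+ p′)) * u′       ∎)

  HasValuation-square : ∀ x {p q} → HasValuation x p q → HasValuation (x ⊗ x) (p ℕ.+ p) (q ℕ.+ q)
  HasValuation-square (a /π^ k) {p} {q} (u , π∤u , eq) = u * u , π-prime π∤u π∤u , (begin
    π ^ (q ℕ.+ q) * (a * a)                       ≈⟨ *-congʳ (^-homo-* π q q) ⟩
    (π ^ q * π ^ q) * (a * a)                     ≈⟨ interchange (π ^ q) a ⟩
    (π ^ q * a) * (π ^ q * a)                     ≈⟨ *-cong eq eq ⟩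
    (π ^ (k ℕ.+ p) * u) * (π ^ (k ℕ.+ p) * u)     ≈⟨ interchange (π ^ (k ℕ.+ p)) u ⟨
    (π ^ (k ℕ.+ p) * π ^ (k ℕ.+ p)) * (u * u)     ≈⟨ *-congʳ (^-homo-* π (k ℕ.+ p) (k ℕ.+ p)) ⟨
    π ^ ((k ℕ.+ p) ℕ.+ (k ℕ.+ p)) * (u * u)       ≡⟨ ≡.cong (λ e → π ^ e * (u * u)) (ℕ+.interchange k p k p) ⟩
    π ^ ((k ℕ.+ k) ℕ.+ (p ℕ.+ p)) * (u * u)       ∎)
    where
    interchange : ∀ s a → (s * s) * (a * a) ≈ (s * a) * (s * a)
    interchange = solve 2 (λ s a → (s :* s) :* (a :* a) := (s :* a) :* (s :* a)) refl

  HasValuation⇒≋̸0 : ∀ x {p q} → HasValuation x p q → ¬ x ≋ fromRing 0#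
  HasValuation⇒≋̸0 (a /π^ k) {p} {q} (u , π∤u , eq) a≋0 = π∤u (0# , (begin
    0# * π   ≈⟨ zeroˡ π ⟩
    0#       ≈⟨ u≈0 ⟨
    u        ∎))
    where
    a≈0 : a ≈ 0#
    a≈0 = trans (sym (*-identityˡ a)) (trans a≋0 (zeroʳ _))
    u≈0 : u ≈ 0#
    u≈0 = π^-cancel (k ℕ.+ p) (trans (sym eq) (trans (*-congˡ a≈0) (trans (zeroʳ _) (sym (zeroʳ _)))))

  fromValuation : ∀ x {γ} → Valuation x [ γ ] → HasValuation x (positive γ) (negative γ)
  fromValuation (a /π^ k) (finite {+ n} u π∤u eq) = u , π∤u , (begin
    1# * a               ≈⟨ eq ⟩
    π ^ k * (π ^ n * u)  ≈⟨ *-assoc _ _ _ ⟨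
    π ^ k * π ^ n * u    ≈⟨ *-congʳ (^-homo-* π k n) ⟨
    π ^ (k ℕ.+ n) * u    ∎)
  fromValuation (a /π^ k) (finite { -[1+ n ]} u π∤u eq) = u , π∤u , (begin
    π ^ suc n * a          ≡⟨ ≡.cong (λ e → π ^ e * a) (ℕ.+-identityʳ (suc n)) ⟨
    π ^ (suc n ℕ.+ 0) * a  ≈⟨ eq ⟩
    π ^ k * (1# * u)       ≈⟨ *-congˡ (*-identityˡ u) ⟩
    π ^ k * u              ≡⟨ ≡.cong (λ e → π ^ e * u) (ℕ.+-identityʳ k) ⟨
    π ^ (k ℕ.+ 0) * u      ∎)

  difference : ∀ w a x n {u} → π ∤ u → x ≈ a + π ^ n * u → w ⊕ fromRing a ≋ fromRing x → HasValuation w n 0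
  difference (b /π^ l) a x n {u} π∤u x≈ eq = u , π∤u , +-cancelˡ (π ^ l * a) _ _ (begin
    π ^ l * a + 1# * b              ≈⟨ +-comm _ _ ⟩
    1# * b + π ^ l * a              ≈⟨ *-identityˡ _ ⟨
    1# * (1# * b + π ^ l * a)       ≈⟨ eq ⟩
    π ^ (l ℕ.+ 0) * x               ≡⟨ ≡.cong (λ e → π ^ e * x) (ℕ.+-identityʳ l) ⟩
    π ^ l * x                       ≈⟨ *-congˡ x≈ ⟩
    π ^ l * (a + π ^ n * u)         ≈⟨ solve 4 (λ l a n u → l :* (a :+ n :* u) := l :* a :+ l :* n :* u)
                                         refl (π ^ l) a (π ^ n) u ⟩
    π ^ l * a + π ^ l * π ^ n * u   ≈⟨ +-congˡ (*-congʳ (^-homo-* π l n)) ⟨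
    π ^ l * a + π ^ (l ℕ.+ n) * u   ∎)

  -- Parameter and point are both restricted to the valuation ring, where the category argument
  -- takes place.
  EvenDistance : Carrier → Pred Carrier (c ⊔ ℓ)
  EvenDistance a = definedSet structure evenDistance (fromRing a ∷ []) ∘ fromRing

  evenDistance-holds : ∀ {a x m u} → π ∤ u → x ≈ a + π ^ (2 ℕ.* m) * u → EvenDistance a x
  evenDistance-holds {a} {x} {m} {u} π∤u x≈ none = none z w
    (lift w+a≈x) (_ , _ , v-z , v-z , [ ℤ.≤-refl ])
    (_ , _ , v-z² , v-w , [ ℤ.≤-refl ]) (_ , _ , v-w , v-z² , [ ℤ.≤-refl ])
    where
    z w : Fraction
    z = fromRing (π ^ m)
    w = fromRing (π ^ (2 ℕ.* m) * u)
    v-z : Valuation z [ + m ]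
    v-z = finite 1# π-nonunit (*-congˡ (sym (*-identityʳ _)))
    v-w : Valuation w [ + (2 ℕ.* m) ]
    v-w = finite u π∤u refl
    v-z² : Valuation (z ⊗ z) [ + (2 ℕ.* m) ]
    v-z² = finite 1# π-nonunit (*-congˡ (begin
      π ^ m * π ^ m          ≈⟨ ^-homo-* π m m ⟨
      π ^ (m ℕ.+ m)          ≡⟨ ≡.cong (λ e → π ^ (m ℕ.+ e)) (ℕ.+-identityʳ m) ⟨
      π ^ (2 ℕ.* m)          ≈⟨ *-identityʳ _ ⟨
      π ^ (2 ℕ.* m) * 1#     ∎))
    w+a≈x : w ⊕ fromRing a ≋ fromRing x
    w+a≈x = *-congˡ (begin
      1# * (π ^ (2 ℕ.* m) * u) + 1# * a  ≈⟨ +-cong (*-identityˡ _) (*-identityˡ _) ⟩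
      π ^ (2 ℕ.* m) * u + a              ≈⟨ +-comm _ _ ⟩
      a + π ^ (2 ℕ.* m) * u              ≈⟨ x≈ ⟨
      x                                  ∎)

  Valuation-unique : ∀ x {p q γ} → HasValuation x p q → Valuation x γ → γ ≡ [ p ℤ.⊖ q ]
  Valuation-unique x {p} {q} h (infinite x≋0) = contradiction x≋0 (HasValuation⇒≋̸0 x {p} {q} h)
  Valuation-unique x {p} {q} h v@(finite {γ} _ _ _) = ≡.cong [_] (≡.trans (≡.sym (positive⊖negative γ))
    (⊖-cong-+ (positive γ) (negative γ) p q (HasValuation-unique x {positive γ} {negative γ} {p} {q} (fromValuation x v) h)))

  square≋0 : ∀ z → z ≋ fromRing 0# → z ⊗ z ≋ fromRing 0#
  square≋0 (a /π^ k) z≋0 = begin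
    1# * (a * a)  ≈⟨ *-assoc _ _ _ ⟨
    1# * a * a    ≈⟨ *-congʳ z≋0 ⟩
    π ^ k * 0# * a ≈⟨ *-congʳ (zeroʳ _) ⟩
    0# * a        ≈⟨ zeroˡ a ⟩
    0#            ≈⟨ zeroʳ _ ⟨
    π ^ (k ℕ.+ k) * 0# ∎

  associate-of-square : ∀ w z n p q → HasValuation w n 0 → HasValuation z p q →
                        (z ⊗ z) ∣ᵛ w → w ∣ᵛ (z ⊗ z) → n ℕ.+ 2 ℕ.* q ≡ 2 ℕ.* p
  associate-of-square w z n p q v-w v-z (_ , _ , v-z² , v-w′ , γ≤δ) (_ , _ , v-w″ , v-z²′ , δ≤γ)
    with Valuation-unique w {n} {0} v-w v-w′ | Valuation-unique w {n} {0} v-w v-w″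
       | Valuation-unique (z ⊗ z) {p ℕ.+ p} {q ℕ.+ q} (HasValuation-square z {p} {q} v-z) v-z²
       | Valuation-unique (z ⊗ z) {p ℕ.+ p} {q ℕ.+ q} (HasValuation-square z {p} {q} v-z) v-z²′
       | γ≤δ | δ≤γ
  ... | ≡.refl | ≡.refl | ≡.refl | ≡.refl | [ γ≤n ] | [ n≤γ ] =
      ≡.subst₂ (λ s t → n ℕ.+ s ≡ t) (double q) (double p)
        (+≡⊖⇒+≡ n (p ℕ.+ p) (q ℕ.+ q) (ℤ.≤-antisym n≤γ γ≤n))
    where
    double : ∀ k → k ℕ.+ k ≡ 2 ℕ.* k
    double k = ≡.cong (k ℕ.+_) (≡.sym (ℕ.+-identityʳ k))

  square-even : ∀ w z n → HasValuation w n 0 → z ∣ᵛ z → (z ⊗ z) ∣ᵛ w → w ∣ᵛ (z ⊗ z) →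
                ∃₂ λ p q → n ℕ.+ 2 ℕ.* q ≡ 2 ℕ.* p
  square-even w z n v-w (_ , _ , v@(finite {ε} _ _ _) , _) z²∣w w∣z² = positive ε , negative ε ,
    associate-of-square w z n (positive ε) (negative ε) v-w (fromValuation z v) z²∣w w∣z²
  -- Here `z` is zero, yet v(z²) ≤ v(w) = n forces a finite value on z².
  square-even w z n v-w (_ , _ , infinite z≋0 , _) (_ , _ , v-z² , v-w′ , γ≤δ) _
    with Valuation-unique w {n} {0} v-w v-w′ | v-z² | γ≤δ
  ... | ≡.refl | v@(finite {γ} _ _ _) | [ _ ] = contradiction (square≋0 z z≋0)
    (HasValuation⇒≋̸0 (z ⊗ z) {positive γ} {negative γ} (fromValuation (z ⊗ z) v))

  evenDistance-fails : ∀ {a x n m u} → suc n ≡ 2 ℕ.* m → π ∤ u → x ≈ a + π ^ n * u → ¬ EvenDistance a x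
  evenDistance-fails {a} {x} {n} {m} 1+n≡2m π∤u x≈ even = Polymorphic.⊥-elim (even λ z w (lift w+a≈x) z∣z z²∣w w∣z² →
    let p , q , n+2q≡2p = square-even w z n (difference w a x n π∤u x≈ w+a≈x) z∣z z²∣w w∣z² in
    -- From n + 1 = 2m and n + 2q = 2p follows 2(m + q) = 2p + 1.
    ⊥-elim (ℕ.even≢odd (m ℕ.+ q) p (≡.trans (ℕ.*-distribˡ-+ 2 m q)
      (≡.trans (≡.cong (ℕ._+ 2 ℕ.* q) (≡.sym 1+n≡2m)) (≡.cong suc n+2q≡2p)))))

  alternates : ∀ {a y z} n → Exact a y n → Exact a z (suc n) → ¬ Agree (EvenDistance a) y z
  alternates {a} {y} {z} n y-exact z-exact (y⇒z , z⇒y)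
    with exact-unit {a} {y} {n} y-exact | exact-unit {a} {z} {suc n} z-exact | parity n
  ... | u , π∤u , y≈ | u′ , π∤u′ , z≈ | inj₁ (m , ≡.refl) =
    evenDistance-fails {n = suc n} {suc m} (≡.sym (ℕ.*-suc 2 m)) π∤u′ z≈ (y⇒z (evenDistance-holds {m = m} π∤u y≈))
  ... | u , π∤u , y≈ | u′ , π∤u′ , z≈ | inj₂ (m , 1+n≡2m) =
    evenDistance-fails {n = n} {m} 1+n≡2m π∤u y≈ (z⇒y (evenDistance-holds {m = m} π∤u′
      (≡.subst (λ k → z ≈ a + π ^ k * u′) 1+n≡2m z≈)))

  -- Boolean combinations of instances and parameter-free formulas, restricted to the ring

  module _ (Ψ : FormulaFamily Lᵈⁱᵛ) where

    𝓑 : Instance Ψ structure → Pred Carrier (c ⊔ ℓ)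
    𝓑 i = instanceSet Ψ structure i ∘ fromRing

    χ : Formula Lᵈⁱᵛ 1 → Pred Carrier (c ⊔ ℓ)
    χ φ = definedSet structure φ [] ∘ fromRing

    generated : BooleanCombination (Generator Ψ structure) → Pred Carrier (c ⊔ ℓ)
    generated β = evalBool (generatorSet Ψ structure) β ∘ fromRing

    Supported : List (Instance Ψ structure) → BooleanCombination (Generator Ψ structure) → ℕ → Set (c ⊔ ℓ)
    Supported is β m = ∀ {u v} → All (λ φ → Agree (χ φ) u v) (formulas 1 m) →
                       All (λ i → Agree (𝓑 i) u v) is → Agree (generated β) u v

    -- A boolean combination does not separate points which its finitely many generators do not
    -- separate. Agreement is two-sided so that it survives complements.
    support : ∀ β → ∃ λ is → Eventually (Supported is β)
    support (gen (inj₁ i)) = i ∷ [] , 0 , λ _ _ → All.head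
    support (gen (inj₂ φ)) = [] , proj₁ (formulas-complete φ) , λ le agree _ →
      All.lookup agree (proj₂ (formulas-complete φ) le)
    support (¬′ β) with support β
    ... | is , m₀ , s = is , m₀ , λ le χs is →
      let u⇒v , v⇒u = s le χs is in (λ ¬u v → ¬u (v⇒u v)) , (λ ¬v u → ¬v (u⇒v u))
    support (β ∧ γ) with support β | support γ
    ... | is , s | js , t with eventually-× {P = Supported is β} {Q = Supported js γ} s t
    ...   | m₀ , st = is ++ js , m₀ , λ le χs ijs →
      let u⇒v , v⇒u = proj₁ (st le) χs (All.++⁻ˡ is ijs)
          u⇒v′ , v⇒u′ = proj₂ (st le) χs (All.++⁻ʳ is ijs)
      in (λ (p , q) → u⇒v p , u⇒v′ q) , (λ (p , q) → v⇒u p , v⇒u′ q)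
    support (β ∨ γ) with support β | support γ
    ... | is , s | js , t with eventually-× {P = Supported is β} {Q = Supported js γ} s t
    ...   | m₀ , st = is ++ js , m₀ , λ le χs ijs →
      let u⇒v , v⇒u = proj₁ (st le) χs (All.++⁻ˡ is ijs)
          u⇒v′ , v⇒u′ = proj₂ (st le) χs (All.++⁻ʳ is ijs)
      in Sum.map u⇒v u⇒v′ , Sum.map v⇒u v⇒u′

  not-quasiVCMinimal : (∀ {a : Level} → ExcludedMiddle a) → ¬ QuasiVCMinimal c ℓ (Th structure)
  not-quasiVCMinimal em (Ψ , directed , definable) =
    not-all-determined (formulas 1) determined
    where
    directed′ : Directed (𝓑 Ψ)
    directed′ i j with directed structure id i j
    ... | inj₁ i⊆j        = inj₁ i⊆j
    ... | inj₂ (inj₁ j⊆i) = inj₂ (inj₁ j⊆i)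
    ... | inj₂ (inj₂ i⊥j) = inj₂ (inj₂ i⊥j)

    open DirectedFamily em tree (𝓑 Ψ) directed′ (χ Ψ) EvenDistance (λ {_} {_} {_} {n} → alternates n)

    determined : ∀ a → ∃ λ m → DeterminedOver (formulas 1) m (EvenDistance a)
    determined a with definable structure id evenDistance (fromRing a ∷ [])
    ... | β , φ⊆β , β⊆φ with support Ψ β
    -- The maximum is a stage late enough for the formulas in `β` and large enough for the number of
    -- instances.
    ...   | is , m₀ , s = m₀ ℕ.⊔ length is , length is , ℕ.m≤n⊔m m₀ (length is) , List.lookup is ,
      λ χs agree u → β⊆φ (proj₁ (s (ℕ.m≤m⊔n m₀ (length is)) χs
        (≡.subst (All _) (List.tabulate-lookup is) (All.tabulate⁺ agree))) (φ⊆β u))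

-- ℤₚ and k[[t]]

module RingIdentities {c ℓ} (R : CommutativeRing c ℓ) where
  open CommutativeRing R
  open Algebra.Properties.Semiring.Exp semiring using (_^_)
  open Relation.Binary.Reasoning.Setoid setoid

  *-^-suc : ∀ π n u q r → q * π ≈ u → q ≈ π ^ n * r → u ≈ π ^ suc n * r
  *-^-suc π n u q r qπ≈u q≈ = begin
    u                  ≈⟨ qπ≈u ⟨
    q * π              ≈⟨ *-comm q π ⟩
    π * q              ≈⟨ *-congˡ q≈ ⟩
    π * (π ^ n * r)    ≈⟨ *-assoc _ _ _ ⟨
    π ^ suc n * r      ∎

  minus⇒plus : ∀ a b d → a - b ≈ d → a ≈ b + d
  minus⇒plus a b d a-b≈d = begin
    a              ≈⟨ +-identityʳ a ⟨
    a + 0#         ≈⟨ +-congˡ (-‿inverseˡ b) ⟨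
    a + (- b + b)  ≈⟨ +-assoc _ _ _ ⟨
    a - b + b      ≈⟨ +-comm _ _ ⟩
    b + (a - b)    ≈⟨ +-congˡ a-b≈d ⟩
    b + d          ∎

module PAdicIntegers (p : ℕ) .{{nz : ℕ.NonZero p}} (isPrime : Prime p) where
  open PAdic p {{nz}}
  open ℤₚ
  open CommutativeRing ℤₚ-commutativeRing hiding (zero)
  open Algebra.Definitions.RawMagma *-rawMagma using (_∣_; _∤_; _,_)
  open Algebra.Properties.Semiring.Exp semiring using (_^_)
  open ℤ-Solver using (solve; _:=_; _:+_; _:*_; _:-_; :-_)
  open RingIdentities ℤₚ-commutativeRing

  π : ℤₚ
  π = const (+ p)

  p∣pⁿ : ∀ n → + p ℤ.∣ pⁿ (suc n)
  p∣pⁿ n = divides (pⁿ n) (ℤ.*-comm (+ p) (pⁿ n))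

  ∣-resp-mod : ∀ {m} a b → a ≡ b [mod m ] → m ℤ.∣ a → m ℤ.∣ b
  ∣-resp-mod a b a≡b m∣a = via (ℤ.∣m∣n⇒∣m+n m∣a (ℤ.∣m⇒∣-m a≡b))
    (solve 2 (λ a b → a :+ :- (a :- b) := b) ≡.refl a b)

  residue-mod-p : ∀ u n → residue u (suc n) ≡ residue u 1 [mod + p ]
  residue-mod-p u zero    = refl-mod (residue u 1)
  residue-mod-p u (suc n) = trans-mod (residue u (suc (suc n))) (residue u (suc n)) (residue u 1)
    (ℤ.∣-trans (p∣pⁿ n) (coherent u (suc n))) (residue-mod-p u n)

  -- Division by p loses one digit of precision: the residue of the quotient modulo pⁿ comes from
  -- that of `u` modulo pⁿ⁺¹.
  module ShiftedQuotient (u : ℤₚ) (r : ℕ → ℤ) (exact : ∀ n → residue u (suc n) ≡ r n ℤ.* + p) where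

    quotient : ℤₚ
    quotient = record
      { residue  = r
      ; coherent = λ n → ℤ.*-cancelˡ-∣ (+ p) (via (coherent u (suc n))
          (≡.trans (≡.cong₂ ℤ._-_ (exact (suc n)) (exact n))
            (solve 3 (λ a b p → a :* p :- b :* p := p :* (a :- b)) ≡.refl (r (suc n)) (r n) (+ p))))
      }

    quotient*π : quotient * π ≈ u
    quotient*π n = via (coherent u n) (≡.cong (ℤ._- residue u n) (exact n))

  -- Residue 1 is the first to carry information, residue 0 being taken modulo 1. The exact integer
  -- equation is returned because `divideByπ^` cancels p from a divisibility of representatives.
  divideByπ : ∀ u → + p ℤ.∣ residue u 1 →
              ∃ λ q → q * π ≈ u × (∀ n → residue u (suc n) ≡ residue q n ℤ.* + p)
  divideByπ u p∣u₁ = quotient , quotient*π , exact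
    where
    p∣u : ∀ n → + p ℤ.∣ residue u (suc n)
    p∣u n = ∣-resp-mod (residue u 1) (residue u (suc n))
      (sym-mod (residue u (suc n)) (residue u 1) (residue-mod-p u n)) p∣u₁

    exact : ∀ n → residue u (suc n) ≡ ℤ.quotient (p∣u n) ℤ.* + p
    exact n = ℤ._∣_.equality (p∣u n)

    open ShiftedQuotient u (λ n → ℤ.quotient (p∣u n)) exact

  π∣⇒p∣ : ∀ {u} → π ∣ u → + p ℤ.∣ residue u 1
  π∣⇒p∣ {u} (q , eq) = ∣-resp-mod (residue q 1 ℤ.* + p) (residue u 1)
    (ℤ.∣-trans (p∣pⁿ 0) (eq 1)) (divides (residue q 1) ≡.refl)

  p∣⇒π∣ : ∀ {u} → + p ℤ.∣ residue u 1 → π ∣ u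
  p∣⇒π∣ {u} p∣u₁ = let q , eq , _ = divideByπ u p∣u₁ in q , eq

  π-nonunit : π ∤ 1#
  π-nonunit π∣1 = ¬prime[1] (≡.subst Prime (ℕ.∣1⇒≡1 (ℤ.∣⇒∣ᵤ (π∣⇒p∣ π∣1))) isPrime)

  π-prime : ∀ {u v} → π ∤ u → π ∤ v → π ∤ (u * v)
  π-prime {u} {v} π∤u π∤v π∣uv
    with euclidsLemma (ℤ.∣_∣ (residue u 1)) (ℤ.∣_∣ (residue v 1)) isPrime
           (≡.subst (p ℕ.∣_) (ℤ.abs-* (residue u 1) (residue v 1)) (ℤ.∣⇒∣ᵤ (π∣⇒p∣ π∣uv)))
  ... | inj₁ p∣u = π∤u (p∣⇒π∣ (ℤ.∣ᵤ⇒∣ p∣u))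
  ... | inj₂ p∣v = π∤v (p∣⇒π∣ (ℤ.∣ᵤ⇒∣ p∣v))

  residue-π^ : ∀ n k → residue (π ^ n) k ≡ pⁿ n
  residue-π^ zero    k = ≡.refl
  residue-π^ (suc n) k = ≡.cong (+ p ℤ.*_) (residue-π^ n k)

  divideByπ^ : ∀ n u → pⁿ n ℤ.∣ residue u n → ∃ λ q → u ≈ π ^ n * q
  divideByπ^ zero    u _ = u , λ n → ≡⇒≡mod (≡.sym (ℤ.*-identityˡ (residue u n)))
  divideByπ^ (suc n) u d =
    let q , qπ≈u , exact = divideByπ u (∣-resp-mod (residue u (suc n)) (residue u 1)
                             (residue-mod-p u n) (ℤ.∣-trans (p∣pⁿ n) d))
        r , q≈ = divideByπ^ n q (ℤ.*-cancelˡ-∣ (+ p) (via d (≡.trans (exact n) (ℤ.*-comm (residue q n) (+ p)))))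
    in r , *-^-suc π n u q r qπ≈u q≈

  -- The limit is the diagonal; its n-th residue is literally that of `s n`, so the difference is
  -- divisible by πⁿ.
  complete : ∀ (s : ℕ → ℤₚ) → (∀ n → ∃ λ q → s (suc n) ≈ s n + π ^ n * q) →
             ∃ λ a → ∀ n → ∃ λ q → a ≈ s n + π ^ n * q
  complete s cauchy = limit , λ n →
    let q , eq = divideByπ^ n (limit - s n) (via (divides (+ 0) ≡.refl) (≡.sym (ℤ.+-inverseʳ (residue (s n) n))))
    in q , minus⇒plus limit (s n) (π ^ n * q) eq
    where
    step : ∀ n → residue (s (suc n)) n ≡ residue (s n) n [mod pⁿ n ]
    step n with cauchy n
    ... | q , eq = trans-mod (residue (s (suc n)) n) _ (residue (s n) n) (eq n)
      (divides (residue q n) (≡.trans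
        (≡.cong (λ e → residue (s n) n ℤ.+ e ℤ.* residue q n ℤ.- residue (s n) n) (residue-π^ n n))
        (solve 3 (λ a e q → a :+ e :* q :- a := q :* e) ≡.refl (residue (s n) n) (pⁿ n) (residue q n))))

    limit : ℤₚ
    limit = record
      { residue  = λ n → residue (s n) n
      ; coherent = λ n → trans-mod (residue (s (suc n)) (suc n)) (residue (s (suc n)) n) _
                           (coherent (s (suc n)) n) (step n)
      }

  not-quasiVCMinimal : (∀ {a : Level} → ExcludedMiddle a) →
                       ¬ QuasiVCMinimal 0ℓ 0ℓ (Th (PAdic.structure p {{nz}}))
  not-quasiVCMinimal = CompleteDVR.not-quasiVCMinimal ℤₚ-commutativeRing (const (+ p)) p-cancel record
    { nonunit = π-nonunit ; prime = λ {u} {v} → π-prime {u} {v} ; complete = complete }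

module FormalPowerSeries {c ℓ} (k : CommutativeRing c ℓ) (isField : IsField k) where
  open PowerSeries k
  open IsField isField
  open CommutativeRing k
    using (_≈_; _*_; 0#; 1#; refl; sym; trans; setoid; +-cong; +-congˡ; +-identityʳ; -‿inverseʳ;
           *-congˡ; *-congʳ; *-assoc; *-comm; *-identityʳ; zeroˡ)
  module S = CommutativeRing commutativeRing
  open Algebra.Definitions.RawMagma S.*-rawMagma using (_∣_; _∤_; _,_)
  open Algebra.Properties.Semiring.Exp S.semiring using (_^_)
  open Relation.Binary.Reasoning.Setoid setoid
  open RingIdentities commutativeRing using (minus⇒plus)

  t⋆-zero : ∀ f → (t ⋆ f) 0 ≈ 0#
  t⋆-zero f = trans (+-identityʳ _) (zeroˡ _)

  divideByt : ∀ f → f 0 ≈ 0# → t ⋆ tail f ≈ˢ f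
  divideByt f f₀≈0 zero    = trans (t⋆-zero (tail f)) (sym f₀≈0)
  divideByt f f₀≈0 (suc n) = t⋆-suc (tail f) n

  t∣⇒≈0 : ∀ {f} → t ∣ f → f 0 ≈ 0#
  t∣⇒≈0 {f} (q , eq) = trans (sym (eq 0)) (trans (⋆-comm q t 0) (t⋆-zero q))

  ≈0⇒t∣ : ∀ {f} → f 0 ≈ 0# → t ∣ f
  ≈0⇒t∣ {f} f₀≈0 = tail f , λ n → trans (⋆-comm (tail f) t n) (divideByt f f₀≈0 n)

  t-nonunit : t ∤ one
  t-nonunit t∣1 = 0≉1 (sym (t∣⇒≈0 t∣1))

  -- Divisibility by t is vanishing of the constant coefficient; that of `f` is invertible in the
  -- field, so it can be cancelled from the product.
  t-prime : ∀ {f g} → t ∤ f → t ∤ g → t ∤ (f ⋆ g)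
  t-prime {f} {g} t∤f t∤g t∣fg with inverse (f 0) (λ f₀≈0 → t∤f (≈0⇒t∣ f₀≈0))
  ... | y , f₀y≈1 = t∤g (≈0⇒t∣ (begin
    g 0              ≈⟨ *-identityʳ _ ⟨
    g 0 * 1#         ≈⟨ *-congˡ f₀y≈1 ⟨
    g 0 * (f 0 * y)  ≈⟨ *-assoc _ _ _ ⟨
    g 0 * f 0 * y    ≈⟨ *-congʳ (*-comm _ _) ⟩
    f 0 * g 0 * y    ≈⟨ *-congʳ (+-identityʳ _) ⟨
    (f ⋆ g) 0 * y    ≈⟨ *-congʳ (t∣⇒≈0 t∣fg) ⟩
    0# * y           ≈⟨ zeroˡ y ⟩
    0#               ∎))

  divideByt^ : ∀ n f → (∀ {i} → i < n → f i ≈ 0#) → ∃ λ q → f ≈ˢ (t ^ n) ⋆ q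
  divideByt^ zero    f _  = f , S.sym (S.*-identityˡ f)
  divideByt^ (suc n) f lo with divideByt^ n (tail f) (λ i<n → lo (s≤s i<n))
  ... | q , eq = q , S.trans (S.sym (divideByt f (lo (s≤s z≤n))))
                       (S.trans (S.*-congˡ {t} eq) (S.sym (⋆-assoc t (t ^ n) q)))

  t^⋆-low : ∀ {n i} q → i < n → ((t ^ n) ⋆ q) i ≈ 0#
  t^⋆-low {suc n} {zero}  q _ = trans (⋆-assoc t (t ^ n) q 0) (t⋆-zero ((t ^ n) ⋆ q))
  t^⋆-low {suc n} {suc i} q (s≤s i<n) = trans (⋆-assoc t (t ^ n) q (suc i))
    (trans (t⋆-suc ((t ^ n) ⋆ q) i) (t^⋆-low q i<n))

  complete : ∀ (s : ℕ → Series) → (∀ n → ∃ λ q → s (suc n) ≈ˢ s n +ˢ (t ^ n) ⋆ q) →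
             ∃ λ a → ∀ n → ∃ λ q → a ≈ˢ s n +ˢ (t ^ n) ⋆ q
  complete s cauchy = limit , λ n →
    let q , eq = divideByt^ n (limit S.- s n) (λ {i} i<n → trans (+-cong (stable (ℕ.≤⇒≤′ i<n)) refl) (-‿inverseʳ _))
    in q , minus⇒plus limit (s n) ((t ^ n) ⋆ q) eq
    where
    limit : Series
    -- Successive terms `s n` and `s (suc n)` agree only below n, so coefficient `i` is stable from
    -- `suc i` on.
    limit i = s (suc i) i

    stable : ∀ {n i} → suc i ℕ.≤′ n → limit i ≈ s n i
    stable ≤′-refl = refl
    stable {suc n} {i} (≤′-step i<n) with cauchy n
    ... | q , eq = trans (stable i<n) (sym (trans (eq i)
      (trans (+-congˡ (t^⋆-low q (ℕ.≤′⇒≤ i<n))) (+-identityʳ _))))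

  not-quasiVCMinimal : (∀ {a : Level} → ExcludedMiddle a) → ¬ QuasiVCMinimal c ℓ (Th (k ⟨⟨t⟩⟩))
  not-quasiVCMinimal = CompleteDVR.not-quasiVCMinimal commutativeRing t t-cancel record
    { nonunit = t-nonunit ; prime = λ {f} {g} → t-prime {f} {g} ; complete = complete }

corollary4p8 : (∀ {a : Level} → ExcludedMiddle a) → ∀ {c ℓ : Level} →
    ((p : ℕ) (isPrime : Prime p) → ¬ QuasiVCMinimal 0ℓ 0ℓ (Th (ℚₚ p isPrime)))
    × ((k : CommutativeRing c ℓ) → IsField k → ¬ QuasiVCMinimal c ℓ (Th (k ⟨⟨t⟩⟩)))
-- The irrelevant NonZero instance is left to unification: given explicitly, it
-- differs from the one inside ℚₚ, and comparing the two structures is very slow.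
corollary4p8 em =
    (λ p isPrime → PAdicIntegers.not-quasiVCMinimal p {{_}} isPrime em)
  , (λ k isField → FormalPowerSeries.not-quasiVCMinimal k isField em)
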